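{- Let $G$ be a connected unicyclic graph of order $n$ which is not a cycle, whose unique cycle has length $\ell\geq 6$. Then $trc(G)=2n-7$ if $G\in\{B_6\}\cup\mathcal{J}_1$; otherwise $trc(G)\leq 2n-9$.
   Context: All graphs are finite, simple and undirected. A total-coloring assigns colors to all vertices and edges; a path is total-rainbow if its edges and internal vertices receive pairwise distinct colors; $trc(G)$ is the minimum number of colors in a total-coloring of the connected graph $G$ such that every two distinct vertices are joined by a total-rainbow path. For a connected unicyclic graph $G$ with cycle $C_\ell=u_1u_2\cdots u_\ell u_1$, let $T_i$ ($1\le i\le \ell$) be the component containing $u_i$ of the graph obtained from $G$ by deleting the edges of $C_\ell$ (a tree rooted at $u_i$); $\mathcal{T}_G=\{T_1,\dots,T_\ell\}$, and $T_i$ is nontrivial if it contains at least one edge. $B_6$ denotes the graph of order $n$ consisting of a $6$-cycle $u_1\cdots u_6u_1$ together with a nontrivial path $T_1$ having $u_1$ as an end vertex and meeting the cycle only in $u_1$ (so only $T_1$ is nontrivial). $\mathcal{J}_1$ is the set of unicyclic graphs $G$ of order $n$ with cycle length $6$ such that $\mathcal{T}_G$ contains exactly two nontrivial elements and $diam(G)=n-3$. -}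

module Defs where

open import Data.Nat using (ℕ; _≤_; _<_; suc; _∸_)
open import Data.Fin using (Fin)
open import Data.Bool using (Bool; true; false)
open import Data.List using (List; []; _∷_; _++_; map; length)
open import Data.List.Relation.Unary.All using (All)
open import Data.List.Relation.Unary.Unique.Propositional using (Unique)
open import Data.List.Membership.Propositional using (_∈_)
open import Data.Product using (Σ; ∃; ∃-syntax; _×_; _,_; proj₁; proj₂)
open import Data.Sum using (_⊎_)
open import Relation.Nullary using (¬_)
open import Relation.Binary.PropositionalEquality using (_≡_; _≢_)
open import Relation.Binary.Construct.Closure.ReflexiveTransitive using (Star)

record Graph (n : ℕ) : Set where
  field
    adj    : Fin n → Fin n → Bool
    sym    : ∀ u v → adj u v ≡ adj v u
    irrefl : ∀ v → adj v v ≡ false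
open Graph public

pairs : {A : Set} → List A → List (A × A)
pairs []          = []
pairs (x ∷ [])    = []
pairs (x ∷ y ∷ r) = (x , y) ∷ pairs (y ∷ r)

Chain : {A : Set} → (A → A → Set) → List A → Set
Chain R xs = All (λ p → R (proj₁ p) (proj₂ p)) (pairs xs)

module _ {n : ℕ} (G : Graph n) where

  E : Fin n → Fin n → Set
  E u v = adj G u v ≡ true

  Connected : Set
  Connected = ∀ u v → Star E u v

  pathVerts : Fin n → List (Fin n) → Fin n → List (Fin n)
  pathVerts u mid v = u ∷ mid ++ v ∷ []

  IsPath : Fin n → List (Fin n) → Fin n → Set
  IsPath u mid v = Unique (pathVerts u mid v) × Chain E (pathVerts u mid v)

  -- d(u,v) ≤ k  (a path has length (number of edges) = suc (length mid))
  DistLe : Fin n → Fin n → ℕ → Set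
  DistLe u v k = u ≡ v ⊎ (∃[ mid ] IsPath u mid v × suc (length mid) ≤ k)

  HasDiam : ℕ → Set
  HasDiam d = (∀ u v → DistLe u v d)
            × (∃[ u ] ∃[ v ] (∀ k → k < d → ¬ DistLe u v k))

  record TotalColoring (k : ℕ) : Set where
    field
      vcol     : Fin n → Fin k
      ecol     : Fin n → Fin n → Fin k
      ecol-sym : ∀ u v → ecol u v ≡ ecol v u
  open TotalColoring public

  pathColors : ∀ {k} → TotalColoring k → Fin n → List (Fin n) → Fin n → List (Fin k)
  pathColors c u mid v =
    map (λ p → ecol c (proj₁ p) (proj₂ p)) (pairs (pathVerts u mid v)) ++ map (vcol c) mid

  TotalRainbowConnected : ∀ {k} → TotalColoring k → Set
  TotalRainbowConnected c =
    ∀ u v → u ≢ v → ∃[ mid ] IsPath u mid v × Unique (pathColors c u mid v)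

  TRCColorable : ℕ → Set
  TRCColorable k = Σ (TotalColoring k) TotalRainbowConnected

  TrcIs : ℕ → Set
  TrcIs m = TRCColorable m × (∀ k → k < m → ¬ TRCColorable k)

  TrcAtMost : ℕ → Set
  TrcAtMost m = ∃[ k ] k ≤ m × TRCColorable k

  record Cycle : Set where
    field
      start : Fin n
      rest  : List (Fin n)
      long  : 2 ≤ length rest
      uniq  : Unique (start ∷ rest)
      closed : Chain E (start ∷ rest ++ start ∷ [])
  open Cycle public

  cverts : Cycle → List (Fin n)
  cverts C = start C ∷ rest C

  cycLength : Cycle → ℕ
  cycLength C = length (cverts C)

  cedges : Cycle → List (Fin n × Fin n)
  cedges C = pairs (start C ∷ rest C ++ start C ∷ [])

  CycEdge : Cycle → Fin n → Fin n → Set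
  CycEdge C x y = (x , y) ∈ cedges C ⊎ (y , x) ∈ cedges C

  SameCycle : Cycle → Cycle → Set
  SameCycle C D = ∀ x y → (CycEdge C x y → CycEdge D x y) × (CycEdge D x y → CycEdge C x y)

  UniqueCycle : Cycle → Set
  UniqueCycle C = ∀ (D : Cycle) → SameCycle C D

  IsCycleGraph : Set
  IsCycleGraph = ∃[ C ] (∀ v → v ∈ cverts C) × (∀ x y → E x y → CycEdge C x y)

  -- The trees T_i: components of G − E(C)

  F : Cycle → Fin n → Fin n → Set
  F C x y = E x y × ¬ CycEdge C x y

  InTree : Cycle → Fin n → Fin n → Set
  InTree C u x = Star (F C) u x

  Nontrivial : Cycle → Fin n → Set
  Nontrivial C u = ∃[ x ] ∃[ y ] InTree C u x × InTree C u y × F C x y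

  PathTreeFrom : Cycle → Fin n → Set
  PathTreeFrom C u =
    ∃[ ps ] ps ≢ []
          × Unique (u ∷ ps)
          × Chain (F C) (u ∷ ps)
          × (∀ x → (InTree C u x → x ∈ u ∷ ps) × (x ∈ u ∷ ps → InTree C u x))
          × (∀ x y → InTree C u x → F C x y →
               (x , y) ∈ pairs (u ∷ ps) ⊎ (y , x) ∈ pairs (u ∷ ps))

  InB6 : Cycle → Set
  InB6 C = cycLength C ≡ 6
         × ∃[ u ] u ∈ cverts C × PathTreeFrom C u
                × (∀ w → w ∈ cverts C → w ≢ u → ¬ Nontrivial C w)

  InJ1 : Cycle → Set
  InJ1 C = cycLength C ≡ 6
         × (∃[ u ] ∃[ v ] u ∈ cverts C × v ∈ cverts C × u ≢ v
              × Nontrivial C u × Nontrivial C v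
              × (∀ w → w ∈ cverts C → Nontrivial C w → w ≡ u ⊎ w ≡ v))
         × HasDiam (n ∸ 3)

{-# OPTIONS --safe #-}
module Submission where

-- Upper bounds.  If a set S of vertices carries a partial total-colouring with k colours in which any
-- two members of S are joined inside S by a total-rainbow path, then a neighbour x of y ∈ S can be added
-- at the cost of two fresh colours, one for the vertex y and one for the edge xy.  So in a connected
-- graph 2|S| - k never decreases, and it suffices to exhibit in G a small subgraph saving enough:
-- C₆ with 5 colours saves 7, while C₈ and C₇ with a leaf (7 colours), longer cycles C_ℓ (ℓ colours),
-- C₆ with leaves at two vertices at distance 1 or 2 (7 colours), and C₆ with a stem that ends in a fork
-- all save 9.  A unicyclic graph on C₆ containing none of the latter has only paths, attached
-- at one vertex (B₆) or at two opposite vertices (𝒥₁).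
--
-- Lower bound.  Those exceptions have diameter n - 3, and a path of length d shows 2d - 1 colours.

open import Defs hiding (sym)
open import Data.Nat using (ℕ; zero; suc; _+_; _*_; _∸_; _≤_; _<_; z≤n; s≤s; _%_; _⊓_; _⊔_; NonZero)
open import Data.Nat.Properties using (≤-refl; ≤-trans; ≤-reflexive; <-trans; <⇒≢; m<n⇒m<1+n; m≤n⇒m≤1+n; m≤m+n; m≤n+m; +-suc; +-comm; +-assoc; +-identityʳ; ≤-pred; <-≤-trans; <-cmp; m+[n∸m]≡n; *-monoʳ-≤; *-suc; <⇒≱; m<m+n; <⇒≤; _≤?_; _<?_; ≰⇒>; ≮⇒≥; ≤-antisym; ≤-total; +-monoʳ-≤; +-monoˡ-≤; *-monoˡ-≤; +-cancelˡ-≡; ⊓-comm; m<n⇒0<n∸m; +-mono-≤; ∸-monoˡ-≤; m+n≤o⇒m≤o∸n; n∸n≡0; *-distribˡ-+; ⊔-comm; module ≤-Reasoning)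
import Data.Nat.Properties as ℕ
open import Data.Nat.Tactic.RingSolver using (solve-∀)
import Data.Product as Product
open import Data.Product.Properties using (≡-dec)
open import Data.Nat.DivMod using (_/_; m≡m%n+[m/n]*n; m%n<n; m<n⇒m%n≡m; m%n%n≡m%n; %-distribˡ-+; [m+n]%n≡m%n; n%n≡0)
open import Relation.Binary.Definitions using (tri<; tri≈; tri>)
open import Data.Fin using (Fin; toℕ; fromℕ<; inject≤)
open import Data.Fin.Properties using (_≟_; any?; all?; ¬∀⟶∃¬; toℕ-fromℕ<; toℕ-injective; inject≤-injective; injective⇒≤)
open import Data.List using (List; []; _∷_; _++_; map; length; reverse; lookup; filter; upTo; concatMap)
open import Data.List.Properties using (unfold-reverse; reverse-++; map-++; map-∘; length-++; length-map; ++-assoc; ++-identityʳ; length-reverse)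
open import Data.List.Relation.Unary.All as All using (All; []; _∷_)
import Data.List.Relation.Unary.All.Properties as All
open import Data.List.Relation.Unary.Any as Any using (Any; here; there)
import Data.List.Relation.Unary.Any.Properties as Any
open import Data.List.Relation.Unary.AllPairs as AllPairs using (AllPairs; []; _∷_)
import Data.List.Relation.Unary.AllPairs.Properties as AllPairs
open import Data.List.Relation.Unary.Unique.Propositional using (Unique)
import Data.List.Relation.Unary.Unique.Propositional.Properties as Unique
open import Data.List.Membership.Propositional using (_∈_; _∉_)
open import Data.List.Membership.Propositional.Properties using (∈-++⁺ˡ; ∈-++⁺ʳ; ∈-++⁻; ∈-∃++; ∈-upTo⁺)
open import Data.List.Relation.Binary.Permutation.Propositional using (_↭_; prep; ↭-sym; ↭-trans; ↭-refl; ↭⇒↭ₛ)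
open import Data.List.Relation.Binary.Permutation.Propositional.Properties using (shift; ↭-reverse; ↭-length; ∈-resp-↭; ++-comm)
import Data.List.Relation.Binary.Permutation.Setoid.Properties as Permₛ
import Data.List.Relation.Binary.Permutation.Propositional.Properties as Perm
open import Data.Product using (∃; ∃₂; _×_; _,_; proj₁; proj₂)
import Data.Sum as Sum
open import Data.Sum using (_⊎_; inj₁; inj₂; [_,_]′; swap)
open import Data.Empty using (⊥; ⊥-elim)
open import Function using (_∘_; id)
open import Relation.Nullary using (¬_; Dec; yes; no; contradiction)
open import Relation.Nullary.Decidable using (True; toWitness; from-yes; _×-dec_; _⊎-dec_; ¬?)
open import Relation.Binary.PropositionalEquality using (_≡_; _≢_; refl; sym; trans; cong; cong₂; subst; subst₂; setoid; resp₂; ≢-sym)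
open import Relation.Binary.Construct.Closure.ReflexiveTransitive as Star using (Star; ε; _◅_; _◅◅_)
open import Data.List.Membership.DecPropositional as DecMem using ()
open import Data.Bool using (true)
import Data.Bool.Properties as Bool

-- Two families of saving subgraphs have unbounded size. Long cycles get a formula, but a fork may
-- hang on a stem of any length and is no finite pattern. The obstacle is that plain extension keeps
-- the saving constant and forgets how colours are distributed, so a fork met late could gain
-- nothing. The remedy is a deliberately poorer start: C₆ with 7 colours saves only 5, but two of
-- its colours α and β are reserved, in that every vertex is reached from the root by a rainbow path
-- missing α, and by another missing β. Stem edges and stem vertices get only new colours, so the
-- tip of the stem inherits this property and the saving stays 5. At the fork the two new edges are
-- coloured α and β; two vertices arrive without any new colour, and the saving rises by 4 to 9. A
-- fork at the cycle itself is the case of a stem of length 0.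

private variable
  V W : Set

-- Repetition-free lists and counting in `Fin n`.

AllPairs-resp-↭ : {R : V → V → Set} → (∀ {a b} → R a b → R b a) →
                  ∀ {xs ys} → xs ↭ ys → AllPairs R xs → AllPairs R ys
AllPairs-resp-↭ {R = R} s p = Permₛ.AllPairs-resp-↭ (setoid _) s (resp₂ R) (↭⇒↭ₛ p)

Unique-resp-↭ : ∀ {xs ys : List V} → xs ↭ ys → Unique xs → Unique ys
Unique-resp-↭ = AllPairs-resp-↭ ≢-sym

AllPairs-mapWith : {P : V → Set} {R Q : V → V → Set} →
                   (∀ {a b} → P a → P b → R a b → Q a b) →
                   ∀ {xs} → All P xs → AllPairs R xs → AllPairs Q xs
AllPairs-mapWith f []         []         = []
AllPairs-mapWith f (px ∷ pxs) (rx ∷ rxs) =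
  All.map (λ (pb , r) → f px pb r) (All.zip (pxs , rx)) ∷ AllPairs-mapWith f pxs rxs

∉⇒All≢ : ∀ {x : V} {xs} → x ∉ xs → All (x ≢_) xs
∉⇒All≢ {xs = xs} x∉ = All.tabulate (λ v∈ x≡v → x∉ (subst (_∈ xs) (sym x≡v) v∈))

unique-lookup-injective : ∀ {xs : List V} → Unique xs → ∀ {i j} → lookup xs i ≡ lookup xs j → i ≡ j
unique-lookup-injective (_ ∷ _)  {Fin.zero}  {Fin.zero}  _  = refl
unique-lookup-injective {xs = _ ∷ xs} (p ∷ _)  {Fin.zero}  {Fin.suc j} eq =
  contradiction eq (All.lookup p (lookup∈ xs j))
  where
  lookup∈ : ∀ (ys : List V) k → lookup ys k ∈ ys
  lookup∈ (y ∷ ys) Fin.zero    = here refl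
  lookup∈ (y ∷ ys) (Fin.suc k) = there (lookup∈ ys k)
unique-lookup-injective (p ∷ u) {Fin.suc i} {Fin.zero}  eq =
  sym (unique-lookup-injective (p ∷ u) {Fin.zero} {Fin.suc i} (sym eq))
unique-lookup-injective (_ ∷ u) {Fin.suc i} {Fin.suc j} eq = cong Fin.suc (unique-lookup-injective u eq)

unique⇒length≤ : ∀ {n} {xs : List (Fin n)} → Unique xs → length xs ≤ n
unique⇒length≤ {xs = xs} u = injective⇒≤ {f = lookup xs} (unique-lookup-injective u)

covering⇒≤length : ∀ {n} {xs : List (Fin n)} → (∀ v → v ∈ xs) → n ≤ length xs
covering⇒≤length {xs = xs} c = injective⇒≤ {f = λ v → Any.index (c v)} λ {v} {w} eq →
  trans (Any.lookup-index (c v)) (trans (cong (lookup xs) eq) (sym (Any.lookup-index (c w))))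

-- Routes and the items that they colour.

data Item (V : Set) : Set where
  vtx : V → Item V
  edg : V → V → Item V

-- The item list omits the end vertices, whose colours do not count for total-rainbowness.
data Route {V : Set} (A : V → V → Set) : V → V → List V → List (Item V) → Set where
  edge : ∀ {u v} → A u v → Route A u v (u ∷ v ∷ []) (edg u v ∷ [])
  step : ∀ {u w v vs is} → A u w → Route A w v vs is → Route A u v (u ∷ vs) (edg u w ∷ vtx w ∷ is)

mapItem : (V → W) → Item V → Item W
mapItem h (vtx v)   = vtx (h v)
mapItem h (edg u v) = edg (h u) (h v)

data Ends {V : Set} (P : V → Set) : Item V → Set where
  vtx : ∀ {v} → P v → Ends P (vtx v)
  edg : ∀ {u v} → P u → P v → Ends P (edg u v)

-- The start of a repetition-free route still occurs in its items, as an end of the first edge; a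
-- condition such as "different from the start" must therefore leave edges free.
data Inner {V : Set} (P : V → Set) : Item V → Set where
  vtx : ∀ {v} → P v → Inner P (vtx v)
  edg : ∀ {u v} → Inner P (edg u v)

pathItems : List V → List V → List (Item V)
pathItems vs mid = map (λ p → edg (proj₁ p) (proj₂ p)) (pairs vs) ++ map vtx mid

module _ {A : V → V → Set} where

  Route-map : ∀ {B : W → W → Set} (h : V → W) → (∀ {a b} → A a b → B (h a) (h b)) →
              ∀ {u v vs is} → Route A u v vs is → Route B (h u) (h v) (map h vs) (map (mapItem h) is)
  Route-map h f (edge a)   = edge (f a)
  Route-map h f (step a r) = step (f a) (Route-map h f r)

  route-start : ∀ {P : V → Set} {u v vs is} → Route A u v vs is → All P vs → P u
  route-start (edge _)   (p ∷ _) = p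
  route-start (step _ _) (p ∷ _) = p

  route-ends : ∀ {P : V → Set} {u v vs is} → Route A u v vs is → All P vs → All (Ends P) is
  route-ends (edge _)   (p ∷ q ∷ []) = edg p q ∷ []
  route-ends (step _ r) (p ∷ ps)     = edg p (route-start r ps) ∷ vtx (route-start r ps) ∷ route-ends r ps

  route-inner : ∀ {P : V → Set} {u v vs is} → Route A u v (u ∷ vs) is → All P vs → All (Inner P) is
  route-inner (edge _)            _        = edg ∷ []
  route-inner (step _ r@(edge _))   (p ∷ ps) = edg ∷ vtx p ∷ route-inner r ps
  route-inner (step _ r@(step _ _)) (p ∷ ps) = edg ∷ vtx p ∷ route-inner r ps

  route-snoc : ∀ {u v w vs is} → Route A u v vs is → A v w →
               Route A u w (vs ++ w ∷ []) (is ++ vtx v ∷ edg v w ∷ [])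
  route-snoc (edge a)   b = step a (edge b)
  route-snoc (step a r) b = step a (route-snoc r b)

  -- Reversal turns `edg u w` into `edg w u`, so the item lists are not literally reverse to each
  -- other; only their colours are.
  route-reverse : (∀ {a b} → A a b → A b a) → (col : Item V → ℕ) → (∀ a b → col (edg a b) ≡ col (edg b a)) →
                  ∀ {u v vs is} → Route A u v vs is →
                  ∃ λ js → Route A v u (reverse vs) js × map col js ≡ reverse (map col is)
  route-reverse s col cs (edge {u} {v} a) = _ , edge (s a) , cong (_∷ []) (cs v u)
  route-reverse s col cs (step {u} {w} {vs = vs} {is} a r) with js , r′ , eq ← route-reverse s col cs r =
    _ , subst (λ z → Route A _ _ z _) (sym (unfold-reverse u vs)) (route-snoc r′ (s a)) , eq′
    where
    open Relation.Binary.PropositionalEquality.≡-Reasoning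
    eq′ : map col (js ++ vtx w ∷ edg w u ∷ []) ≡ reverse (col (edg u w) ∷ col (vtx w) ∷ map col is)
    eq′ = begin
      map col (js ++ vtx w ∷ edg w u ∷ [])
        ≡⟨ map-++ col js _ ⟩
      map col js ++ col (vtx w) ∷ col (edg w u) ∷ []
        ≡⟨ cong₂ (λ x c → x ++ col (vtx w) ∷ c ∷ []) eq (cs w u) ⟩
      reverse (map col is) ++ col (vtx w) ∷ col (edg u w) ∷ []
        ≡⟨ ++-assoc (reverse (map col is)) (col (vtx w) ∷ []) _ ⟨
      (reverse (map col is) ++ col (vtx w) ∷ []) ++ col (edg u w) ∷ []
        ≡⟨ cong (_++ col (edg u w) ∷ []) (unfold-reverse (col (vtx w)) (map col is)) ⟨
      reverse (col (vtx w) ∷ map col is) ++ col (edg u w) ∷ []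
        ≡⟨ unfold-reverse (col (edg u w)) (col (vtx w) ∷ map col is) ⟨
      reverse (col (edg u w) ∷ col (vtx w) ∷ map col is) ∎

  -- A route interleaves edges and inner vertices while `pathColors` lists all edges first, hence
  -- the permutation.
  route⇒path : ∀ {u v vs is} → Route A u v vs is →
               ∃ λ mid → vs ≡ u ∷ mid ++ v ∷ [] × Chain A vs × is ↭ pathItems vs mid
  route⇒path (edge a) = [] , refl , a ∷ [] , ↭-refl
  route⇒path (step {u} {w} a r) with mid , refl , ch , p ← route⇒path r =
    w ∷ mid , refl , a ∷ ch ,
    prep (edg u w) (↭-trans (prep (vtx w) p) (↭-sym (shift (vtx w) (map (λ p → edg (proj₁ p) (proj₂ p)) (pairs (w ∷ mid ++ _))) (map vtx mid))))

module _ {n : ℕ} where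
  open DecMem (_≟_ {n}) public using (_∈?_)

-- Colourings of a vertex set and their extension by one vertex.

module _ {n : ℕ} (G : Graph n) where

  private
    Vx = Fin n

  E-sym : ∀ {u v : Vx} → E G u v → E G v u
  E-sym {u} {v} e = trans (Graph.sym G v u) e

  E⇒≢ : ∀ {u v : Vx} → E G u v → u ≢ v
  E⇒≢ {u} e refl with () ← trans (sym e) (irrefl G u)

  Differ : (Item Vx → ℕ) → Item Vx → Item Vx → Set
  Differ col a b = col a ≢ col b

  Rainbow : (Item Vx → ℕ) → List Vx → Vx → Vx → Set
  Rainbow col S u v = ∃₂ λ vs is →
    Route (E G) u v vs is × Unique vs × All (_∈ S) vs × AllPairs (Differ col) is

  -- The colour γ and that of the first vertex stay available for prolonging the path backwards.
  RainbowFrom : (Item Vx → ℕ) → List Vx → ℕ → Vx → Vx → Set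
  RainbowFrom col S γ u v = ∃₂ λ vs is →
    Route (E G) u v vs is × Unique vs × All (_∈ S) vs
    × AllPairs (Differ col) (vtx u ∷ is) × All (λ a → γ ≢ col a) (vtx u ∷ is)

  Conn : (Item Vx → ℕ) → List Vx → Set
  Conn col S = ∀ {u v} → u ∈ S → v ∈ S → u ≢ v → Rainbow col S u v

  Rooted : (Item Vx → ℕ) → List Vx → Vx → ℕ → Set
  Rooted col S r γ = γ ≢ col (vtx r) × (∀ {v} → v ∈ S → v ≢ r → RainbowFrom col S γ r v)

  Symmetric : (Item Vx → ℕ) → Set
  Symmetric col = ∀ u v → col (edg u v) ≡ col (edg v u)

  Bounded : (Item Vx → ℕ) → ℕ → Set
  Bounded col k = ∀ a → col a < k

  Rainbow-sym : ∀ {col S} → Symmetric col → ∀ {u v} → Rainbow col S u v → Rainbow col S v u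
  Rainbow-sym {col} cs (vs , is , r , un , inS , d) with js , r′ , eq ← route-reverse E-sym col cs r =
    reverse vs , js , r′ , Unique-resp-↭ (↭-sym (↭-reverse vs)) un ,
    Perm.All-resp-↭ (↭-sym (↭-reverse vs)) inS ,
    AllPairs.map⁻ (subst (AllPairs _≢_) (sym eq)
      (Unique-resp-↭ (↭-sym (↭-reverse (map col is))) (AllPairs.map⁺ d)))

  Rainbow-recolour : ∀ {col col′ S T} → (∀ {v} → v ∈ S → v ∈ T) →
    (∀ {a b} → Ends (_∈ S) a → Ends (_∈ S) b → Differ col a b → Differ col′ a b) →
    ∀ {u v} → Rainbow col S u v → Rainbow col′ T u v
  Rainbow-recolour sub f (vs , is , r , un , inS , d) =
    vs , is , r , un , All.map sub inS , AllPairs-mapWith f (route-ends r inS) d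

  Agree : (col col′ : Item Vx → ℕ) → List Vx → Set
  Agree col col′ S = ∀ a → Ends (_∈ S) a → col a ≡ col′ a

  agree-differ : ∀ {col col′ S} → Agree col col′ S →
    ∀ {a b} → Ends (_∈ S) a → Ends (_∈ S) b → Differ col a b → Differ col′ a b
  agree-differ ag ea eb d = subst₂ _≢_ (ag _ ea) (ag _ eb) d

  RainbowFrom-recolour : ∀ {col col′ S T γ u v} → (∀ {v} → v ∈ S → v ∈ T) → Agree col col′ S →
    u ∈ S → RainbowFrom col S γ u v → RainbowFrom col′ T γ u v
  RainbowFrom-recolour sub ag u∈ (vs , is , r , un , inS , d , av) =
    vs , is , r , un , All.map sub inS , AllPairs-mapWith (agree-differ ag) ends d ,
    All.map (λ (e , ne) → subst (_ ≢_) (ag _ e) ne) (All.zip (ends , av))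
    where ends = vtx u∈ ∷ route-ends r inS

  setVtx : (Item Vx → ℕ) → Vx → ℕ → Item Vx → ℕ
  setVtx col y c (edg u v) = col (edg u v)
  setVtx col y c (vtx v) with v ≟ y
  ... | yes _ = c
  ... | no  _ = col (vtx v)

  Joins : Vx → Vx → Vx → Vx → Set
  Joins x y u v = (u ≡ x × v ≡ y) ⊎ (u ≡ y × v ≡ x)

  joins? : ∀ x y u v → Dec (Joins x y u v)
  joins? x y u v = (u ≟ x ×-dec v ≟ y) ⊎-dec (u ≟ y ×-dec v ≟ x)

  Joins-flip : ∀ {x y u v} → Joins x y u v → Joins x y v u
  Joins-flip (inj₁ (p , q)) = inj₂ (q , p)
  Joins-flip (inj₂ (p , q)) = inj₁ (q , p)

  setEdg : (Item Vx → ℕ) → Vx → Vx → ℕ → Item Vx → ℕ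
  setEdg col x y c (vtx v) = col (vtx v)
  setEdg col x y c (edg u v) with joins? x y u v
  ... | yes _ = c
  ... | no  _ = col (edg u v)

  module _ (col : Item Vx → ℕ) where

    setVtx-same : ∀ y c → setVtx col y c (vtx y) ≡ c
    setVtx-same y c with y ≟ y
    ... | yes _ = refl
    ... | no ne = contradiction refl ne

    setVtx-other : ∀ {y} c a → a ≢ vtx y → col a ≡ setVtx col y c a
    setVtx-other c (edg _ _) _ = refl
    setVtx-other {y} c (vtx v) ne with v ≟ y
    ... | yes refl = contradiction refl ne
    ... | no  _    = refl

    setVtx-bounded : ∀ {k l} → Bounded col k → k ≤ l → ∀ y c → c < l → Bounded (setVtx col y c) l
    setVtx-bounded b k≤l y c c<l (edg u v) = <-≤-trans (b _) k≤l
    setVtx-bounded b k≤l y c c<l (vtx v) with v ≟ y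
    ... | yes _ = c<l
    ... | no  _ = <-≤-trans (b _) k≤l

    setEdg-same : ∀ {x y u v} c → Joins x y u v → setEdg col x y c (edg u v) ≡ c
    setEdg-same {x} {y} {u} {v} c j with joins? x y u v
    ... | yes _ = refl
    ... | no ¬j = contradiction j ¬j

    setEdg-symmetric : Symmetric col → ∀ x y c → Symmetric (setEdg col x y c)
    setEdg-symmetric s x y c u v with joins? x y u v | joins? x y v u
    ... | yes _ | yes _ = refl
    ... | yes p | no ¬p = contradiction (Joins-flip p) ¬p
    ... | no ¬p | yes p = contradiction (Joins-flip p) ¬p
    ... | no _  | no _  = s u v

    setEdg-bounded : ∀ {k l} → Bounded col k → k ≤ l → ∀ x y c → c < l → Bounded (setEdg col x y c) l
    setEdg-bounded b k≤l x y c c<l (vtx v) = <-≤-trans (b _) k≤l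
    setEdg-bounded b k≤l x y c c<l (edg u v) with joins? x y u v
    ... | yes _ = c<l
    ... | no  _ = <-≤-trans (b _) k≤l

    setEdg-agree : ∀ {S x y} c → y ∉ S → Agree col (setEdg col x y c) S
    setEdg-agree c y∉ (vtx v) _ = refl
    setEdg-agree {x = x} {y} c y∉ (edg u v) (edg u∈ v∈) with joins? x y u v
    ... | yes (inj₁ (_ , refl)) = contradiction v∈ y∉
    ... | yes (inj₂ (refl , _)) = contradiction u∈ y∉
    ... | no _ = refl

  module Fresh {col k} (bd : Bounded col k) (y : Vx) (c : ℕ) (k≤c : k ≤ c) where

    col′ : Item Vx → ℕ
    col′ = setVtx col y c

    -- The two colourings disagree at `y`, but a colour outside the old range can only separate
    -- items, never merge them; old rainbow paths therefore survive.
    differ : ∀ {a b} → Differ col a b → Differ col′ a b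
    differ {edg _ _} {edg _ _} d = d
    differ {edg p q} {vtx v}   d with v ≟ y
    ... | yes _ = λ eq → <⇒≢ (<-≤-trans (bd (edg p q)) k≤c) eq
    ... | no  _ = d
    differ {vtx v}   {edg p q} d with v ≟ y
    ... | yes _ = λ eq → <⇒≢ (<-≤-trans (bd (edg p q)) k≤c) (sym eq)
    ... | no  _ = d
    differ {vtx v}   {vtx w}   d with v ≟ y | w ≟ y
    ... | yes refl | yes refl = contradiction refl d
    ... | yes _    | no _     = λ eq → <⇒≢ (<-≤-trans (bd (vtx w)) k≤c) (sym eq)
    ... | no _     | yes _    = λ eq → <⇒≢ (<-≤-trans (bd (vtx v)) k≤c) eq
    ... | no _     | no _     = d

    conn : ∀ {S} → Conn col S → Conn col′ S
    conn C u∈ v∈ ne = Rainbow-recolour id (λ _ _ → differ) (C u∈ v∈ ne)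

    private
      avoid : ∀ {γ} → γ ≢ c → k ≤ γ → ∀ a → γ ≢ col′ a
      avoid γ≢c k≤γ (edg p q) eq = <⇒≢ (<-≤-trans (bd (edg p q)) k≤γ) (sym eq)
      avoid γ≢c k≤γ (vtx v) with v ≟ y
      ... | yes _ = γ≢c
      ... | no  _ = λ eq → <⇒≢ (<-≤-trans (bd (vtx v)) k≤γ) (sym eq)

      start-differs : ∀ {a} → Inner (y ≢_) a → Differ col′ (vtx y) a
      start-differs {a} i eq = <⇒≢ (<-≤-trans (bd a) k≤c)
        (trans (setVtx-other col c a (ne a i)) (trans (sym eq) (setVtx-same col y c)))
        where
        ne : ∀ a → Inner (y ≢_) a → a ≢ vtx y
        ne (vtx v) (vtx i) refl = i refl

    -- The colour `c` now belongs to the vertex `y` alone, which is not an inner vertex of a path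
    -- starting there, and `γ` occurs nowhere at all.
    rooted : ∀ {S γ} → Conn col S → y ∈ S → γ ≢ c → k ≤ γ → Rooted col′ S y γ
    rooted {S} {γ} C y∈ γ≢c k≤γ = avoid γ≢c k≤γ (vtx y) , from
      where
      from : ∀ {v} → v ∈ S → v ≢ y → RainbowFrom col′ S γ y v
      from v∈ ne with C y∈ v∈ (≢-sym ne)
      ... | vs , is , r , un , inS , d =
        vs , is , r , un , inS , All.map start-differs (inner r un) ∷ AllPairs.map differ d ,
        All.universal (avoid γ≢c k≤γ) _
        where
        inner : ∀ {v vs is} → Route (E G) y v vs is → Unique vs → All (Inner (y ≢_)) is
        inner r@(edge _)   (p ∷ _) = route-inner r p
        inner r@(step _ _) (p ∷ _) = route-inner r p

  -- The pendant edge gets the colour `γ`. The vertex `x` keeps whatever colour it had, because it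
  -- is only ever an end of the paths chosen in `x ∷ S`.
  module Attach {col S r γ x} (sy : Symmetric col) (C : Conn col S) (R : Rooted col S r γ)
                (r∈ : r ∈ S) (x∉ : x ∉ S) (e : E G r x) where

    col′ : Item Vx → ℕ
    col′ = setEdg col r x γ

    private
      agree : Agree col col′ S
      agree = setEdg-agree col γ x∉

      new : col′ (edg x r) ≡ γ
      new = setEdg-same col {r} {x} γ (inj₂ (refl , refl))

      new′ : col′ (edg r x) ≡ γ
      new′ = setEdg-same col {r} {x} γ (inj₁ (refl , refl))

      x≢ : ∀ {v} → v ∈ S → x ≢ v
      x≢ v∈ refl = x∉ v∈

    symmetric : Symmetric col′
    symmetric = setEdg-symmetric col sy r x γ

    from : ∀ {v} → v ∈ S → Rainbow col′ (x ∷ S) x v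
    from {v} v∈ with v ≟ r
    ... | yes refl = _ , _ , edge (E-sym e) , (x≢ v∈ ∷ []) ∷ [] ∷ [] ,
                     here refl ∷ there v∈ ∷ [] , [] ∷ []
    ... | no v≢r with vs , is , rt , un , inS , d , av ← RainbowFrom-recolour id agree r∈ (proj₂ R v∈ v≢r) =
      _ , _ , step (E-sym e) rt , All.map x≢ inS ∷ un , here refl ∷ All.map there inS ,
      All.map (λ ne eq → ne (trans (sym new) eq)) av ∷ d

    conn : Conn col′ (x ∷ S)
    conn (here refl) (here refl) ne = contradiction refl ne
    conn (here refl) (there v∈)  ne = from v∈
    conn (there u∈)  (here refl) ne = Rainbow-sym symmetric (from u∈)
    conn (there u∈)  (there v∈)  ne = Rainbow-recolour there (agree-differ agree) (C u∈ v∈ ne)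

    -- Prepares the second edge of a fork. The path from `r` to `x` is the new edge alone, so `γ′`
    -- has to avoid just `γ` and the colour of `r`.
    rooted : ∀ {γ′} → γ′ ≢ γ → Rooted col S r γ′ → Rooted col′ (x ∷ S) r γ′
    rooted {γ′} ne (γ′≢r , R′) = γ′≢r , go
      where
      go : ∀ {v} → v ∈ x ∷ S → v ≢ r → RainbowFrom col′ (x ∷ S) γ′ r v
      go (there v∈)  v≢r = RainbowFrom-recolour there agree r∈ (R′ v∈ v≢r)
      go (here refl) v≢r =
        _ , _ , edge e , (≢-sym (x≢ r∈) ∷ []) ∷ [] ∷ [] , there r∈ ∷ here refl ∷ [] ,
        ((λ eq → proj₁ R (trans (sym new′) (sym eq))) ∷ []) ∷ [] ∷ [] ,
        γ′≢r ∷ (λ eq → ne (trans eq new′)) ∷ []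

  -- Colours are natural numbers under a bound and are given to all items, including those off `S`;
  -- then a new vertex or a new colour changes no type.
  record Colouring (S : List Vx) (k : ℕ) : Set where
    field
      col       : Item Vx → ℕ
      symmetric : Symmetric col
      bounded   : Bounded col k
      conn      : Conn col S

  extend : ∀ {S k y x} → Colouring S k → y ∈ S → x ∉ S → E G y x → Colouring (x ∷ S) (2 + k)
  extend {S} {k} {y} {x} c y∈ x∉ e = record
    { col       = A.col′
    ; symmetric = A.symmetric
    ; bounded   = setEdg-bounded F.col′ (setVtx-bounded col bounded (m≤n+m k 2) y (suc k) ≤-refl)
                    ≤-refl y x k (m<n⇒m<1+n ≤-refl)
    ; conn      = A.conn
    }
    where
    open Colouring c
    module F = Fresh bounded y (suc k) (m≤n⇒m≤1+n ≤-refl)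
    module A = Attach symmetric (F.conn conn) (F.rooted conn y∈ (<⇒≢ ≤-refl) ≤-refl) y∈ x∉ e

  crossing : ∀ {S : List Vx} {u v} → u ∈ S → v ∉ S → Star (E G) u v → ∃₂ λ y x → y ∈ S × x ∉ S × E G y x
  crossing u∈ v∉ ε = contradiction u∈ v∉
  crossing {S} {u} u∈ v∉ (_◅_ {j = w} e s) with w ∈? S
  ... | yes w∈ = crossing w∈ v∉ s
  ... | no w∉  = u , w , u∈ , w∉ , e

  crossing-or-all : Connected G → ∀ {S u} → u ∈ S → (∀ v → v ∈ S) ⊎ (∃₂ λ y x → y ∈ S × x ∉ S × E G y x)
  crossing-or-all cn {S} {u} u∈ with all? (_∈? S)
  ... | yes a = inj₁ a
  ... | no ¬a with v , v∉ ← ¬∀⟶∃¬ n (_∈ S) (_∈? S) ¬a = inj₂ (crossing u∈ v∉ (cn u v))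

  colouring⇒TRC : ∀ {S k} → (∀ v → v ∈ S) → Colouring S k → TRCColorable G k
  colouring⇒TRC {S} {k} all c = tc , rainbow
    where
    open Colouring c
    colF : Item Vx → Fin k
    colF a = fromℕ< (bounded a)

    toℕ-colF : ∀ a → toℕ (colF a) ≡ col a
    toℕ-colF a = toℕ-fromℕ< (bounded a)

    colF-injective : ∀ {a b} → colF a ≡ colF b → col a ≡ col b
    colF-injective {a} {b} eq = trans (sym (toℕ-colF a)) (trans (cong toℕ eq) (toℕ-colF b))

    tc : TotalColoring G k
    tc = record
      { vcol = λ v → colF (vtx v)
      ; ecol = λ u v → colF (edg u v)
      ; ecol-sym = λ u v → toℕ-injective
          (trans (toℕ-colF (edg u v)) (trans (symmetric u v) (sym (toℕ-colF (edg v u)))))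
      }

    colours≡ : ∀ vs mid → map colF (pathItems vs mid)
             ≡ map (λ p → colF (edg (proj₁ p) (proj₂ p))) (pairs vs) ++ map (colF ∘ vtx) mid
    colours≡ vs mid = trans (map-++ colF (map _ (pairs vs)) (map vtx mid))
      (cong₂ _++_ (sym (map-∘ (pairs vs))) (sym (map-∘ mid)))

    rainbow : TotalRainbowConnected G tc
    rainbow u v u≢v with conn (all u) (all v) u≢v
    ... | vs , is , r , un , _ , d with mid , refl , ch , p ← route⇒path r =
      mid , (un , ch) , subst Unique (colours≡ _ mid)
        (AllPairs.map⁺ (AllPairs.map (λ ne eq → ne (colF-injective eq)) (AllPairs-resp-↭ ≢-sym p d)))

  spread : Connected G → ∀ {S k u} c → u ∈ S → Unique S → Colouring S k → k + c ≤ 2 * length S →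
           ∃ λ l → l + c ≤ 2 * n × TRCColorable G l
  spread cn {S} c u∈ un col le = go (n ∸ length S) u∈ un (≤-reflexive (sym (m+[n∸m]≡n (unique⇒length≤ un)))) col le
    where
    -- `fuel` bounds the number of missing vertices. Each extension adds 2 to both sides of
    -- `k + c ≤ 2 * length S`.
    go : ∀ fuel {S k u} → u ∈ S → Unique S → n ≤ length S + fuel → Colouring S k → k + c ≤ 2 * length S →
         ∃ λ l → l + c ≤ 2 * n × TRCColorable G l
    go fuel {S} {k} u∈ un bd col le with crossing-or-all cn u∈
    ... | inj₁ all = k , ≤-trans le (*-monoʳ-≤ 2 (unique⇒length≤ un)) , colouring⇒TRC all col
    go zero {S} u∈ un bd col le | inj₂ (y , x , y∈ , x∉ , e) =
      contradiction (unique⇒length≤ (∉⇒All≢ x∉ ∷ un)) (<⇒≱ (s≤s (subst (n ≤_) (+-identityʳ _) bd)))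
    go (suc fuel) {S} {k} u∈ un bd col le | inj₂ (y , x , y∈ , x∉ , e) =
      go fuel (here refl) (∉⇒All≢ x∉ ∷ un) (subst (n ≤_) (+-suc _ fuel) bd) (extend col y∈ x∉ e)
         (subst (2 + (k + c) ≤_) (sym (*-suc 2 (length S))) (s≤s (s≤s le)))

-- Transport of a coloured pattern on numbers into a graph.

nth : V → List V → ℕ → V
nth d []       _       = d
nth d (x ∷ xs) zero    = x
nth d (x ∷ xs) (suc i) = nth d xs i

nth∈ : ∀ (d : V) xs {i} → i < length xs → nth d xs i ∈ xs
nth∈ d (x ∷ xs) {zero}  _       = here refl
nth∈ d (x ∷ xs) {suc i} (s≤s p) = there (nth∈ d xs p)

nth-beyond : ∀ (d : V) xs → nth d xs (length xs) ≡ d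
nth-beyond d []       = refl
nth-beyond d (x ∷ xs) = nth-beyond d xs

-- The default `d` acts as the entry after the last one, so the final step of the chain is included.
-- With `d` the head of a cycle this is the closing edge.
chain-nth : ∀ {R : V → V → Set} (d : V) xs → Chain R (xs ++ d ∷ []) →
            ∀ {i} → i < length xs → R (nth d xs i) (nth d xs (suc i))
chain-nth d (x ∷ [])     (r ∷ _)  {zero}  _       = r
chain-nth d (x ∷ [])     _        {suc i} (s≤s ())
chain-nth d (x ∷ y ∷ xs) (r ∷ _)  {zero}  _       = r
chain-nth d (x ∷ y ∷ xs) (_ ∷ ch) {suc i} (s≤s p) = chain-nth d (y ∷ xs) ch p

module _ {n : ℕ} where

  position : List (Fin n) → Fin n → ℕ
  position []       v = 0
  position (x ∷ xs) v with v ≟ x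
  ... | yes _ = 0
  ... | no  _ = suc (position xs v)

  position-nth : ∀ d {xs} → Unique xs → ∀ {i} → i < length xs → position xs (nth d xs i) ≡ i
  position-nth d {x ∷ xs} _ {zero} _ with x ≟ x
  ... | yes _ = refl
  ... | no ne = contradiction refl ne
  position-nth d {x ∷ xs} (p ∷ u) {suc i} (s≤s lt) with nth d xs i ≟ x
  ... | yes eq = contradiction (sym eq) (All.lookup p (nth∈ d xs lt))
  ... | no  _  = cong suc (position-nth d u lt)

  position< : ∀ {xs v} → v ∈ xs → position xs v < length xs
  position< {x ∷ xs} {v} v∈ with v ≟ x
  position< v∈          | yes _ = s≤s z≤n
  position< (here eq)   | no ne = contradiction eq ne
  position< (there v∈)  | no _  = s≤s (position< v∈)

  nth-position : ∀ d {xs v} → v ∈ xs → nth d xs (position xs v) ≡ v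
  nth-position d {x ∷ xs} {v} v∈ with v ≟ x
  nth-position d v∈         | yes eq = sym eq
  nth-position d (here eq)  | no ne  = contradiction eq ne
  nth-position d (there v∈) | no _   = nth-position d v∈

module _ {A : V → V → Set} {P : V → Set} (l : ∀ {a b} → A a b → P a) (r : ∀ {a b} → A a b → P b) where

  route-all : ∀ {u v vs is} → Route A u v vs is → All P vs
  route-all (edge a)   = l a ∷ r a ∷ []
  route-all (step a t) = l a ∷ route-all t

RainbowIn : {V : Set} → (V → V → Set) → (Item V → ℕ) → V → V → Set
RainbowIn A c i j = ∃₂ λ vs is → Route A i j vs is × Unique vs × AllPairs (λ a b → c a ≢ c b) is

-- Only the edges of the pattern must be present in `G`; the subgraph on `S` may have more.
module Embed {n} (G : Graph n) (d : Fin n) (S : List (Fin n)) (un : Unique S)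
  (A : ℕ → ℕ → Set) (c : Item ℕ → ℕ)
  (lˡ : ∀ {i j} → A i j → i < length S) (lʳ : ∀ {i j} → A i j → j < length S)
  (hom : ∀ {i j} → A i j → E G (nth d S i) (nth d S j)) where

  h : ℕ → Fin n
  h = nth d S

  colour : Item (Fin n) → ℕ
  colour a = c (mapItem (position S) a)

  colour-h : ∀ {a} → Ends (_< length S) a → colour (mapItem h a) ≡ c a
  colour-h (vtx p)   = cong (λ i → c (vtx i)) (position-nth d un p)
  colour-h (edg p q) = cong₂ (λ i j → c (edg i j)) (position-nth d un p) (position-nth d un q)

  private
    module _ {i j vs is} (r : Route A i j vs is) where
      vs< : All (_< length S) vs
      vs< = route-all lˡ lʳ r

      is< : All (Ends (_< length S)) is
      is< = route-ends r vs<

    differ : ∀ {a b} → Ends (_< length S) a → Ends (_< length S) b → c a ≢ c b →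
             colour (mapItem h a) ≢ colour (mapItem h b)
    differ p q = subst₂ _≢_ (sym (colour-h p)) (sym (colour-h q))

    unique-h : ∀ {vs} → All (_< length S) vs → Unique vs → Unique (map h vs)
    unique-h b u = AllPairs.map⁺ (AllPairs-mapWith
      (λ p q ne eq → ne (trans (sym (position-nth d un p)) (trans (cong (position S) eq) (position-nth d un q)))) b u)

    all-h : ∀ {vs} → All (_< length S) vs → All (_∈ S) (map h vs)
    all-h b = All.map⁺ (All.map (nth∈ d S) b)

  rainbow : ∀ {i j} → RainbowIn A c i j → Rainbow G colour S (h i) (h j)
  rainbow (vs , is , r , u , df) =
    _ , _ , Route-map h hom r , unique-h (vs< r) u , all-h (vs< r) ,
    AllPairs.map⁺ (AllPairs-mapWith differ (is< r) df)

  rainbowFrom : ∀ {γ i j vs is} → i < length S → Route A i j vs is → Unique vs →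
    AllPairs (λ a b → c a ≢ c b) (vtx i ∷ is) → All (λ a → γ ≢ c a) (vtx i ∷ is) →
    RainbowFrom G colour S γ (h i) (h j)
  rainbowFrom i< r u df av =
    _ , _ , Route-map h hom r , unique-h (vs< r) u , all-h (vs< r) ,
    AllPairs.map⁺ {f = mapItem h} (AllPairs-mapWith differ ends df) ,
    All.map⁺ {f = mapItem h} (All.map (λ (e , ne) → subst (_ ≢_) (sym (colour-h e)) ne) (All.zip (ends , av)))
    where ends = vtx i< ∷ is< r

  -- A rainbow path in one direction per pair is enough, which admits a one-way adjacency such as
  -- stepping forwards around a cycle.
  colouring : ∀ {k} → (∀ i j → c (edg i j) ≡ c (edg j i)) → (∀ a → c a < k) →
    (∀ {i j} → i < length S → j < length S → i ≢ j → RainbowIn A c i j ⊎ RainbowIn A c j i) →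
    Colouring G S k
  colouring cs cb conn = record
    { col       = colour
    ; symmetric = sy
    ; bounded   = λ a → cb _
    ; conn      = λ {u} {v} u∈ v∈ ne → subst₂ (Rainbow G colour S) (nth-position d u∈) (nth-position d v∈)
        ([ rainbow , Rainbow-sym G sy ∘ rainbow ]′
          (conn (position< u∈) (position< v∈)
            λ eq → ne (trans (sym (nth-position d u∈)) (trans (cong h eq) (nth-position d v∈)))))
    }
    where
    sy : Symmetric G colour
    sy u v = cs (position S u) (position S v)

-- Long cycles: with vertex i coloured 2i and edge ij coloured i + j modulo ℓ,
-- the colours met along an arc are consecutive residues.

upFrom : ℕ → ℕ → List ℕ
upFrom a zero    = []
upFrom a (suc m) = a ∷ upFrom (suc a) m

upFrom-range : ∀ a m → All (λ x → a ≤ x × x < a + m) (upFrom a m)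
upFrom-range a zero    = []
upFrom-range a (suc m) = (≤-refl , m<m+n a (s≤s z≤n)) ∷
  All.map (λ (p , q) → <⇒≤ p , <-≤-trans q (≤-reflexive (sym (+-suc a m)))) (upFrom-range (suc a) m)

module _ (ℓ : ℕ) .{{_ : NonZero ℓ}} where

  -- With equal remainders, comparing quotients puts `x` and `y` either in the wrong order or at
  -- least `ℓ` apart.
  %-distinct : ∀ {x y} → x < y → y < x + ℓ → x % ℓ ≢ y % ℓ
  %-distinct {x} {y} x<y y<x+ℓ eq with y / ℓ ≤? x / ℓ
  ... | yes q = <⇒≱ x<y (begin
    y                     ≡⟨ m≡m%n+[m/n]*n y ℓ ⟩
    y % ℓ + y / ℓ * ℓ     ≤⟨ +-monoʳ-≤ (y % ℓ) (*-monoˡ-≤ ℓ q) ⟩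
    y % ℓ + x / ℓ * ℓ     ≡⟨ cong (_+ x / ℓ * ℓ) eq ⟨
    x % ℓ + x / ℓ * ℓ     ≡⟨ m≡m%n+[m/n]*n x ℓ ⟨
    x                     ∎)
    where open ≤-Reasoning
  ... | no ¬q = <⇒≱ y<x+ℓ (begin
    x + ℓ                      ≡⟨ cong (_+ ℓ) (m≡m%n+[m/n]*n x ℓ) ⟩
    x % ℓ + x / ℓ * ℓ + ℓ      ≡⟨ +-assoc (x % ℓ) _ ℓ ⟩
    x % ℓ + (x / ℓ * ℓ + ℓ)    ≡⟨ cong₂ _+_ eq (+-comm (x / ℓ * ℓ) ℓ) ⟩
    y % ℓ + suc (x / ℓ) * ℓ    ≤⟨ +-monoʳ-≤ (y % ℓ) (*-monoˡ-≤ ℓ (≰⇒> ¬q)) ⟩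
    y % ℓ + y / ℓ * ℓ          ≡⟨ m≡m%n+[m/n]*n y ℓ ⟨
    y                          ∎)
    where open ≤-Reasoning

  upFrom-%-unique : ∀ a m → m ≤ ℓ → Unique (map (_% ℓ) (upFrom a m))
  upFrom-%-unique a zero    _   = []
  upFrom-%-unique a (suc m) m≤ℓ =
    All.map⁺ (All.map (λ (p , q) → %-distinct p (<-≤-trans q (≤-trans (≤-reflexive (sym (+-suc a m))) (+-monoʳ-≤ a m≤ℓ))))
      (upFrom-range (suc a) m))
    ∷ upFrom-%-unique (suc a) m (<⇒≤ m≤ℓ)

  Next : ℕ → ℕ → Set
  Next i j = i < ℓ × j ≡ suc i % ℓ

  sumColour : Item ℕ → ℕ
  sumColour (vtx i)   = (i + i) % ℓ
  sumColour (edg i j) = (i + j) % ℓ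

  next : ∀ a → Next (a % ℓ) (suc a % ℓ)
  next a = m%n<n a ℓ , trans (%-distribˡ-+ 1 a ℓ)
    (trans (cong (λ z → (1 % ℓ + z) % ℓ) (sym (m%n%n≡m%n a ℓ))) (sym (%-distribˡ-+ 1 (a % ℓ) ℓ)))

  private
    route-to : ∀ {x y z vs is} → y ≡ z → Route Next x (y % ℓ) vs is → Route Next x (z % ℓ) vs is
    route-to refl r = r

  -- The index runs on unreduced and only its values are taken modulo `ℓ`, so an arc passing through
  -- vertex 0 needs no case of its own. An arc of `suc e` edges has 2e + 1 items, with sums from 2a
  -- + 1 to 2a + 2e + 1.
  arc : ∀ a e → ∃ λ is → Route Next (a % ℓ) ((a + suc e) % ℓ) (map (_% ℓ) (upFrom a (2 + e))) is
                       × map sumColour is ≡ map (_% ℓ) (upFrom (suc (a + a)) (suc (e + e)))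
  arc a zero = edg (a % ℓ) (suc a % ℓ) ∷ [] ,
    route-to (sym (trans (+-suc a 0) (cong suc (+-identityʳ a)))) (edge (next a)) ,
    cong (_∷ []) (trans (sym (%-distribˡ-+ a (suc a) ℓ)) (cong (_% ℓ) (+-suc a a)))
  arc a (suc e) with is , r , eq ← arc (suc a) e =
    edg (a % ℓ) (suc a % ℓ) ∷ vtx (suc a % ℓ) ∷ is ,
    route-to (sym (+-suc a (suc e))) (step (next a) r) ,
    cong₂ _∷_ (trans (sym (%-distribˡ-+ a (suc a) ℓ)) (cong (_% ℓ) (+-suc a a)))
      (trans (cong₂ _∷_ (trans (sym (%-distribˡ-+ (suc a) (suc a) ℓ)) (cong (λ z → suc z % ℓ) (+-suc a a)))
        (trans eq (cong (λ z → map (_% ℓ) (upFrom (suc (suc z)) (suc (e + e)))) (+-suc a a))))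
        (cong (λ z → map (_% ℓ) (upFrom (suc (suc (a + a))) (suc z))) (sym (+-suc e e))))

  arc-rainbow : ∀ a e → 2 + e ≤ ℓ → suc (e + e) ≤ ℓ → RainbowIn Next sumColour (a % ℓ) ((a + suc e) % ℓ)
  arc-rainbow a e le₁ le₂ with is , r , eq ← arc a e =
    _ , is , r , upFrom-%-unique a (2 + e) le₁ ,
    AllPairs.map⁻ (subst Unique (sym eq) (upFrom-%-unique (suc (a + a)) (suc (e + e)) le₂))

  -- The two arcs between `i` and `j` have e + 1 and f + 1 edges with e + f + 2 = ℓ. If e ≤ f, the
  -- first has 2e + 1 ≤ ℓ - 1 items, and fewer than ℓ consecutive residues are distinct; likewise
  -- for the other.
  cycle-rainbow-< : ∀ {i j} → i < j → j < ℓ → RainbowIn Next sumColour i j ⊎ RainbowIn Next sumColour j i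
  cycle-rainbow-< {i} {j} i<j j<ℓ = go (≤-total e f)
    where
    e = j ∸ suc i
    f = i + ℓ ∸ suc j
    eqj : i + suc e ≡ j
    eqj = trans (+-suc i e) (m+[n∸m]≡n i<j)
    eqi : j + suc f ≡ i + ℓ
    eqi = trans (+-suc j f) (m+[n∸m]≡n (≤-trans j<ℓ (m≤n+m ℓ i)))
    total : suc e + suc f ≡ ℓ
    total = +-cancelˡ-≡ i _ _ (trans (sym (+-assoc i (suc e) (suc f))) (trans (cong (_+ suc f) eqj) eqi))
    total′ : 2 + (e + f) ≡ ℓ
    total′ = trans (cong suc (sym (+-suc e f))) total
    go : e ≤ f ⊎ f ≤ e → _
    go (inj₁ e≤f) = inj₁ (subst₂ (RainbowIn Next sumColour) (m<n⇒m%n≡m (<-trans i<j j<ℓ))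
      (trans (cong (_% ℓ) eqj) (m<n⇒m%n≡m j<ℓ))
      (arc-rainbow i e (≤-trans (+-monoʳ-≤ 2 (m≤m+n e f)) (≤-reflexive total′))
        (≤-trans (s≤s (+-monoʳ-≤ e e≤f)) (≤-trans (m≤n+m _ 1) (≤-reflexive total′)))))
    go (inj₂ f≤e) = inj₂ (subst₂ (RainbowIn Next sumColour) (m<n⇒m%n≡m j<ℓ)
      (trans (cong (_% ℓ) eqi) (trans ([m+n]%n≡m%n i ℓ) (m<n⇒m%n≡m (<-trans i<j j<ℓ))))
      (arc-rainbow j f (≤-trans (+-monoʳ-≤ 2 (m≤n+m f e)) (≤-reflexive total′))
        (≤-trans (s≤s (+-monoˡ-≤ f f≤e)) (≤-trans (m≤n+m _ 1) (≤-reflexive total′)))))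

  cycle-rainbow : ∀ {i j} → i < ℓ → j < ℓ → i ≢ j → RainbowIn Next sumColour i j ⊎ RainbowIn Next sumColour j i
  cycle-rainbow {i} {j} i<ℓ j<ℓ ne with <-cmp i j
  ... | tri< i<j _ _ = cycle-rainbow-< i<j j<ℓ
  ... | tri≈ _ eq _  = contradiction eq ne
  ... | tri> _ _ j<i = swap (cycle-rainbow-< j<i i<ℓ)

cycle-colouring : ∀ {n} (G : Graph n) (C : Cycle G) → Colouring G (cverts G C) (cycLength G C)
cycle-colouring G C = colouring
  (λ i j → cong (_% ℓ) (+-comm i j))
  (λ { (vtx i) → m%n<n (i + i) ℓ ; (edg i j) → m%n<n (i + j) ℓ })
  (cycle-rainbow ℓ)
  where
  ℓ = cycLength G C
  S = cverts G C
  s = start C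
  hom : ∀ {i j} → Next ℓ i j → E G (nth s S i) (nth s S j)
  hom {i} (i<ℓ , refl) with suc i <? ℓ
  ... | yes si<ℓ = subst (λ z → E G (nth s S i) (nth s S z)) (sym (m<n⇒m%n≡m si<ℓ)) (chain-nth s S (closed C) i<ℓ)
  -- Here `suc i` equals `ℓ`: reduced it is 0, unreduced it falls off the list and returns the
  -- default `s`, and both denote the start vertex.
  ... | no ¬si<ℓ = subst (E G (nth s S i))
        (trans (trans (cong (nth s S) eq) (nth-beyond s S)) (cong (nth s S) (sym (trans (cong (_% ℓ) eq) (n%n≡0 ℓ)))))
        (chain-nth s S (closed C) i<ℓ)
    where
    eq : suc i ≡ ℓ
    eq = ≤-antisym i<ℓ (≮⇒≥ ¬si<ℓ)
  next< : ∀ {i j} → Next ℓ i j → j < ℓ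
  next< {i} (_ , refl) = m%n<n (suc i) ℓ
  open Embed G s S (uniq C) (Next ℓ) (sumColour ℓ) proj₁ next< hom

-- Finite patterns, verified by computation.

lookupEdge : ℕ → ℕ → List ((ℕ × ℕ) × ℕ) → ℕ
lookupEdge i j []             = 0
lookupEdge i j ((e , c) ∷ es) with ≡-dec ℕ._≟_ ℕ._≟_ e (i , j)
... | yes _ = c
... | no  _ = lookupEdge i j es

-- Pairs that are not listed receive the default 0. No walk of a pattern uses them, but the bound
-- covers all items, whence `0 < k`.
lookupEdge-< : ∀ {k} i j es → 0 < k → All (λ e → proj₂ e < k) es → lookupEdge i j es < k
lookupEdge-< i j []             0<k []       = 0<k
lookupEdge-< i j ((e , c) ∷ es) 0<k (p ∷ ps) with ≡-dec ℕ._≟_ ℕ._≟_ e (i , j)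
... | yes _ = p
... | no  _ = lookupEdge-< i j es 0<k ps

nth-< : ∀ {k} xs i → 0 < k → All (_< k) xs → nth 0 xs i < k
nth-< []       i       0<k []       = 0<k
nth-< (x ∷ xs) zero    0<k (p ∷ _)  = p
nth-< (x ∷ xs) (suc i) 0<k (_ ∷ ps) = nth-< xs i 0<k ps

-- A totally coloured graph on 0, …, m - 1; edges are listed with the smaller end first.
module Pattern (vcs : List ℕ) (ecs : List ((ℕ × ℕ) × ℕ)) where

  size : ℕ
  size = length vcs

  edges : List (ℕ × ℕ)
  edges = map proj₁ ecs

  Adj : ℕ → ℕ → Set
  Adj i j = (i , j) ∈ edges ⊎ (j , i) ∈ edges

  open DecMem (≡-dec ℕ._≟_ ℕ._≟_) using () renaming (_∈?_ to _∈ₚ?_)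

  adj? : ∀ i j → Dec (Adj i j)
  adj? i j = ((i , j) ∈ₚ? edges) ⊎-dec ((j , i) ∈ₚ? edges)

  colour : Item ℕ → ℕ
  colour (vtx i)   = nth 0 vcs i
  colour (edg i j) = lookupEdge (i ⊓ j) (i ⊔ j) ecs

  colour-sym : ∀ i j → colour (edg i j) ≡ colour (edg j i)
  colour-sym i j = cong₂ (λ a b → lookupEdge a b ecs) (⊓-comm i j) (⊔-comm i j)

  Walk : ℕ → List ℕ → ℕ → Set
  Walk u []              v = ⊥
  Walk u (w ∷ [])        v = w ≡ v × Adj u w
  Walk u (w ∷ ws@(_ ∷ _)) v = Walk w ws v × Adj u w

  walk? : ∀ u ws v → Dec (Walk u ws v)
  walk? u []              v = no id
  walk? u (w ∷ [])        v = (w ℕ.≟ v) ×-dec adj? u w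
  walk? u (w ∷ ws@(_ ∷ _)) v = walk? w ws v ×-dec adj? u w

  items : ℕ → List ℕ → List (Item ℕ)
  items u []              = []
  items u (w ∷ [])        = edg u w ∷ []
  items u (w ∷ ws@(_ ∷ _)) = edg u w ∷ vtx w ∷ items w ws

  walk⇒route : ∀ u ws v → Walk u ws v → Route Adj u v (u ∷ ws) (items u ws)
  walk⇒route u (w ∷ [])        v (refl , a) = edge a
  walk⇒route u (w ∷ ws@(_ ∷ _)) v (wk , a)   = step a (walk⇒route w ws v wk)

  Distinct : List (Item ℕ) → Set
  Distinct = AllPairs (λ a b → colour a ≢ colour b)

  distinct? : ∀ is → Dec (Distinct is)
  distinct? = AllPairs.allPairs? (λ a b → ¬? (colour a ℕ.≟ colour b))

  Good : ℕ → ℕ → List ℕ → Set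
  Good i j ws = Walk i ws j × Unique (i ∷ ws) × Distinct (items i ws)

  good? : ∀ i j ws → Dec (Good i j ws)
  good? i j ws = walk? i ws j ×-dec AllPairs.allPairs? (λ a b → ¬? (a ℕ.≟ b)) (i ∷ ws) ×-dec distinct? (items i ws)

  GoodFrom : ℕ → ℕ → ℕ → List ℕ → Set
  GoodFrom γ i j ws = Good i j ws × Distinct (vtx i ∷ items i ws) × All (λ a → γ ≢ colour a) (vtx i ∷ items i ws)

  goodFrom? : ∀ γ i j ws → Dec (GoodFrom γ i j ws)
  goodFrom? γ i j ws = good? i j ws ×-dec distinct? (vtx i ∷ items i ws)
    ×-dec All.all? (λ a → ¬? (γ ℕ.≟ colour a)) (vtx i ∷ items i ws)

  neighbours : ℕ → List ℕ
  neighbours i = filter (adj? i) (upTo size)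

  walks : ℕ → ℕ → List (List ℕ)
  walks zero    u = []
  walks (suc f) u = concatMap (λ w → (w ∷ []) ∷ map (w ∷_) (walks f w)) (neighbours u)

  -- At most seven colours are ever used, so rainbow paths have at most four edges.
  Joined : (List ℕ → Set) → ℕ → Set
  Joined Q i = Any Q (walks 4 i)

  Valid : ℕ → Set
  Valid k = 0 < k × All (_< k) vcs × All (λ e → proj₂ e < k) ecs
    × All (λ e → proj₁ e < size × proj₂ e < size) edges
    × All (λ i → All (λ j → i ≡ j ⊎ Joined (Good i j) i) (upTo size)) (upTo size)

  valid? : ∀ k → Dec (Valid k)
  valid? k = (0 ℕ.<? k) ×-dec All.all? (λ _ → _ ℕ.<? k) vcs ×-dec All.all? (λ _ → _ ℕ.<? k) ecs
    ×-dec All.all? (λ _ → (_ ℕ.<? size) ×-dec (_ ℕ.<? size)) edges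
    ×-dec All.all? (λ i → All.all? (λ j → (i ℕ.≟ j) ⊎-dec Any.any? (good? i j) (walks 4 i)) (upTo size)) (upTo size)

  RootedAt0 : ℕ → Set
  RootedAt0 γ = γ ≢ colour (vtx 0) × All (λ j → 0 ≡ j ⊎ Joined (GoodFrom γ 0 j) 0) (upTo size)

  rootedAt0? : ∀ γ → Dec (RootedAt0 γ)
  rootedAt0? γ = ¬? (γ ℕ.≟ colour (vtx 0))
    ×-dec All.all? (λ j → (0 ℕ.≟ j) ⊎-dec Any.any? (goodFrom? γ 0 j) (walks 4 0)) (upTo size)

  module Realise {k} (val : Valid k) {n} (G : Graph n) (d : Fin n) (S : List (Fin n)) (len : length S ≡ size)
    (un : Unique S) (es : All (λ e → E G (nth d S (proj₁ e)) (nth d S (proj₂ e))) edges) where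

    private
      0<k = proj₁ val

      ends< : ∀ {i j} → (i , j) ∈ edges → i < length S × j < length S
      ends< e = subst (λ z → _ < z × _ < z) (sym len) (All.lookup (proj₁ (proj₂ (proj₂ (proj₂ val)))) e)

      lˡ : ∀ {i j} → Adj i j → i < length S
      lˡ (inj₁ e) = proj₁ (ends< e)
      lˡ (inj₂ e) = proj₂ (ends< e)

      hom : ∀ {i j} → Adj i j → E G (nth d S i) (nth d S j)
      hom (inj₁ e) = All.lookup es e
      hom (inj₂ e) = E-sym G (All.lookup es e)

    module M = Embed G d S un Adj colour lˡ (lˡ ∘ swap) hom

    private
      bounded : ∀ a → colour a < k
      bounded (vtx i)   = nth-< vcs i 0<k (proj₁ (proj₂ val))
      bounded (edg i j) = lookupEdge-< (i ⊓ j) (i ⊔ j) ecs 0<k (proj₁ (proj₂ (proj₂ val)))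

      ∈size : ∀ {i} → i < length S → i ∈ upTo size
      ∈size p = ∈-upTo⁺ (subst (_ <_) len p)

      conn : ∀ {i j} → i < length S → j < length S → i ≢ j → RainbowIn Adj colour i j
      conn {i} {j} p q ne with All.lookup (All.lookup (proj₂ (proj₂ (proj₂ (proj₂ val)))) (∈size p)) (∈size q)
      ... | inj₁ eq = contradiction eq ne
      ... | inj₂ an with ws , wk , u , df ← Any.satisfied an = _ , _ , walk⇒route i ws j wk , u , df

    colouring : Colouring G S k
    colouring = M.colouring colour-sym bounded (λ p q ne → inj₁ (conn p q ne))

    rooted : ∀ {γ} → RootedAt0 γ → 0 < length S → Rooted G (Colouring.col colouring) S (nth d S 0) γ
    rooted {γ} (ne , rt) 0< = subst (γ ≢_) (sym (M.colour-h (vtx 0<))) ne , go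
      where
      go : ∀ {v} → v ∈ S → v ≢ nth d S 0 → RainbowFrom G M.colour S γ (nth d S 0) v
      go {v} v∈ ne with All.lookup rt (∈size (position< v∈))
      ... | inj₁ eq = contradiction (trans (sym (nth-position d v∈)) (cong (nth d S) (sym eq))) ne
      ... | inj₂ an with ws , (wk , u , _) , df , av ← Any.satisfied an =
        subst (RainbowFrom G M.colour S γ _) (nth-position d v∈) (M.rainbowFrom 0< (walk⇒route 0 ws _ wk) u df av)

-- The following colourings were found by computer search.
module C₆ = Pattern
  (1 ∷ 2 ∷ 4 ∷ 2 ∷ 1 ∷ 3 ∷ [])
  (((0 , 1) , 0) ∷ ((1 , 2) , 3) ∷ ((2 , 3) , 1) ∷ ((3 , 4) , 0) ∷ ((4 , 5) , 2) ∷ ((0 , 5) , 4) ∷ [])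

module C₈ = Pattern
  (1 ∷ 2 ∷ 6 ∷ 5 ∷ 3 ∷ 5 ∷ 3 ∷ 6 ∷ [])
  (((0 , 1) , 0) ∷ ((1 , 2) , 3) ∷ ((2 , 3) , 4) ∷ ((3 , 4) , 1) ∷ ((4 , 5) , 0) ∷ ((5 , 6) , 2) ∷ ((6 , 7) , 4) ∷ ((0 , 7) , 5) ∷ [])

module C₇₊₁ = Pattern
  (0 ∷ 4 ∷ 6 ∷ 2 ∷ 5 ∷ 6 ∷ 5 ∷ 0 ∷ [])
  (((0 , 1) , 1) ∷ ((1 , 2) , 5) ∷ ((2 , 3) , 3) ∷ ((3 , 4) , 0) ∷ ((4 , 5) , 1) ∷ ((5 , 6) , 4) ∷ ((0 , 6) , 3) ∷ ((0 , 7) , 2) ∷ [])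

module AdjacentLeaves = Pattern
  (1 ∷ 2 ∷ 1 ∷ 5 ∷ 6 ∷ 2 ∷ 0 ∷ 0 ∷ [])
  (((0 , 1) , 0) ∷ ((1 , 2) , 3) ∷ ((2 , 3) , 4) ∷ ((3 , 4) , 0) ∷ ((4 , 5) , 3) ∷ ((0 , 5) , 4) ∷ ((0 , 6) , 5) ∷ ((1 , 7) , 6) ∷ [])

module SpacedLeaves = Pattern
  (0 ∷ 3 ∷ 1 ∷ 0 ∷ 5 ∷ 1 ∷ 0 ∷ 0 ∷ [])
  (((0 , 1) , 5) ∷ ((1 , 2) , 6) ∷ ((2 , 3) , 2) ∷ ((3 , 4) , 6) ∷ ((4 , 5) , 3) ∷ ((0 , 5) , 4) ∷ ((0 , 6) , 2) ∷ ((2 , 7) , 4) ∷ [])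

-- The colours 2 and 6 occur once each, on the two edges at vertex 3, opposite the root 0. Shortest
-- paths from 0 to the other vertices miss both, and 3 can be reached from either side, so either
-- colour can be avoided. Vertex 3 repeats the colour of the root, but it is only an end of these
-- paths.
module RootedC₆ = Pattern
  (0 ∷ 3 ∷ 5 ∷ 0 ∷ 1 ∷ 3 ∷ [])
  (((0 , 1) , 1) ∷ ((1 , 2) , 4) ∷ ((2 , 3) , 6) ∷ ((3 , 4) , 2) ∷ ((4 , 5) , 4) ∷ ((0 , 5) , 5) ∷ [])

C₆-valid : C₆.Valid 5
C₆-valid = from-yes (C₆.valid? 5)

C₈-valid : C₈.Valid 7
C₈-valid = from-yes (C₈.valid? 7)

C₇₊₁-valid : C₇₊₁.Valid 7
C₇₊₁-valid = from-yes (C₇₊₁.valid? 7)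

AdjacentLeaves-valid : AdjacentLeaves.Valid 7
AdjacentLeaves-valid = from-yes (AdjacentLeaves.valid? 7)

SpacedLeaves-valid : SpacedLeaves.Valid 7
SpacedLeaves-valid = from-yes (SpacedLeaves.valid? 7)

RootedC₆-valid : RootedC₆.Valid 7
RootedC₆-valid = from-yes (RootedC₆.valid? 7)

RootedC₆-rooted₂ : RootedC₆.RootedAt0 2
RootedC₆-rooted₂ = from-yes (RootedC₆.rootedAt0? 2)

RootedC₆-rooted₆ : RootedC₆.RootedAt0 6
RootedC₆-rooted₆ = from-yes (RootedC₆.rootedAt0? 6)

-- Stems, forks and savings.

module _ {n : ℕ} (G : Graph n) where

  private
    Vx = Fin n

  -- α and β already occur in the colouring; they will be reused on the two edges of a fork at the root,
  -- so that the fork needs no new colour.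
  record RootedColouring (S : List Vx) (r : Vx) (k : ℕ) : Set where
    field
      colouring : Colouring G S k
    open Colouring colouring public
    field
      r∈         : r ∈ S
      {α β}      : ℕ
      α≢β        : α ≢ β
      α<k        : α < k
      β<k        : β < k
      rootedα    : Rooted G col S r α
      rootedβ    : Rooted G col S r β

  module _ {S r k} (R : RootedColouring S r k) where
    open RootedColouring R

    -- The two new vertices are joined through `r` with colours α, that of `r`, and β, which are
    -- distinct; paths from them into `S` continue along the ones that miss α or β.
    branch : ∀ {x y} → x ∉ S → y ∉ S → y ≢ x → E G r x → E G r y → Colouring G (y ∷ x ∷ S) k
    branch {x} {y} x∉ y∉ y≢x ex ey = record
      { col       = B.col′
      ; symmetric = B.symmetric
      ; bounded   = setEdg-bounded G A.col′ (setEdg-bounded G col bounded ≤-refl r x α α<k) ≤-refl r y β β<k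
      ; conn      = B.conn
      }
      where
      module A = Attach G symmetric conn rootedα r∈ x∉ ex
      y∉′ : y ∉ x ∷ S
      y∉′ (here eq)  = y≢x eq
      y∉′ (there y∈) = y∉ y∈
      module B = Attach G A.symmetric A.conn (A.rooted (≢-sym α≢β) rootedβ) (there r∈) y∉′ ey

    private
      -- The paths reserved for α serve again: they do not repeat the colour of `r`, and `k` occurs
      -- nowhere.
      rooted-fresh : Rooted G col S r k
      rooted-fresh = fresh _ , λ v∈ v≢r → let vs , is , rt , un , inS , d , _ = proj₂ rootedα v∈ v≢r in
        vs , is , rt , un , inS , d , All.universal fresh _
        where
        fresh : ∀ a → k ≢ col a
        fresh a eq = <⇒≢ (bounded a) (sym eq)

    -- The edge gets `k` and the new tip `suc k`. A path from the tip is this edge followed by an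
    -- old path from `r` that misses α (or β); the added colours are at least `k`, so both colours
    -- stay reserved.
    lengthen : ∀ {y} → y ∉ S → E G r y → RootedColouring (y ∷ S) y (2 + k)
    lengthen {y} y∉ e = record
      { colouring = record
        { col       = F.col′
        ; symmetric = A.symmetric
        ; bounded   = setVtx-bounded G A.col′ bd (m≤n+m (suc k) 1) y (suc k) ≤-refl
        ; conn      = F.conn A.conn
        }
      ; r∈      = here refl
      ; α≢β     = α≢β
      ; α<k     = <-≤-trans α<k (m≤n+m k 2)
      ; β<k     = <-≤-trans β<k (m≤n+m k 2)
      ; rootedα = moved α<k rootedα
      ; rootedβ = moved β<k rootedβ
      }
      where
      module A = Attach G symmetric conn rooted-fresh r∈ y∉ e
      bd : Bounded G A.col′ (suc k)
      bd = setEdg-bounded G col bounded (m≤n+m k 1) r y k ≤-refl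
      module F = Fresh G bd y (suc k) ≤-refl

      newV : F.col′ (vtx y) ≡ suc k
      newV = setVtx-same G A.col′ y (suc k)

      newE : F.col′ (edg y r) ≡ k
      newE = setEdg-same G col {r} {y} k (inj₂ (refl , refl))

      agree : Agree G col F.col′ S
      agree a e = trans (setEdg-agree G col k y∉ a e) (setVtx-other G A.col′ (suc k) a (not-y e))
        where
        not-y : ∀ {a} → Ends (_∈ S) a → a ≢ vtx y
        not-y (vtx v∈) refl = y∉ v∈

      moved : ∀ {γ} → γ < k → Rooted G col S r γ → Rooted G F.col′ (y ∷ S) y γ
      moved {γ} γ<k (γ≢r , R′) = γ≢newV , go
        where
        γ≢newV : γ ≢ F.col′ (vtx y)
        γ≢newV eq = <⇒≢ (m<n⇒m<1+n γ<k) (trans eq newV)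
        γ≢newE : γ ≢ F.col′ (edg y r)
        γ≢newE eq = <⇒≢ γ<k (trans eq newE)
        newV≢newE : F.col′ (vtx y) ≢ F.col′ (edg y r)
        newV≢newE eq = <⇒≢ ≤-refl (trans (sym newE) (trans (sym eq) newV))

        old : ∀ {a} → Ends (_∈ S) a → F.col′ a < k
        old e = subst (_< k) (agree _ e) (bounded _)

        go : ∀ {v} → v ∈ y ∷ S → v ≢ y → RainbowFrom G F.col′ (y ∷ S) γ y v
        go (here eq) v≢y = contradiction eq v≢y
        go {v} (there v∈) v≢y with v ≟ r
        ... | yes refl = _ , _ , edge (E-sym G e) , (≢-sym v≢y ∷ []) ∷ [] ∷ [] , here refl ∷ there v∈ ∷ [] ,
          (newV≢newE ∷ []) ∷ [] ∷ [] , γ≢newV ∷ γ≢newE ∷ []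
        ... | no v≢r with vs , is , rt , un , inS , d , av ← RainbowFrom-recolour G id agree r∈ (R′ v∈ v≢r) =
          _ , _ , step (E-sym G e) rt , All.map (λ v∈ eq → y∉ (subst (_∈ S) (sym eq) v∈)) inS ∷ un ,
          here refl ∷ All.map there inS ,
          (newV≢newE ∷ All.map (λ e eq → <⇒≢ (m<n⇒m<1+n (old e)) (trans (sym eq) newV)) ends)
            ∷ All.map (λ e eq → <⇒≢ (old e) (trans (sym eq) newE)) ends ∷ d ,
          γ≢newV ∷ γ≢newE ∷ av
          where ends = vtx r∈ ∷ route-ends rt inS

  -- Stated additively, since a truncated difference would hide a bound that fails.
  Saving : ℕ → Set
  Saving c = ∃₂ λ S k → ∃ (_∈ S) × Unique S × Colouring G S k × k + c ≤ 2 * length S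

  -- The result of an exploration that meets no fork. Edges from the stem back into `S` are still
  -- allowed here; uniqueness of the cycle restricts them later.
  ClosedPath : List Vx → Vx → Set
  ClosedPath S t = ∃ λ ps → Unique ps × All (_∉ S) ps × Chain (E G) (t ∷ ps)
                          × (∀ {x z} → x ∈ t ∷ ps → E G x z → z ∈ S ⊎ z ∈ ps)

  newNeighbour? : ∀ S t → Dec (∃ λ y → E G t y × y ∉ S)
  newNeighbour? S t = any? (λ y → (adj G t y Bool.≟ true) ×-dec ¬? (y ∈? S))

  -- The number of new neighbours of the tip decides: none ends the stem, one prolongs it at the
  -- same saving 5, two form a fork, which adds 4.
  explore : ∀ {S t k} → Unique S → RootedColouring S t k → k + 5 ≤ 2 * length S → Saving 9 ⊎ ClosedPath S t
  explore {S} un R le = go (n ∸ length S) un (≤-reflexive (sym (m+[n∸m]≡n (unique⇒length≤ un)))) R le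
    where
    go : ∀ fuel {S t k} → Unique S → n ≤ length S + fuel → RootedColouring S t k → k + 5 ≤ 2 * length S →
         Saving 9 ⊎ ClosedPath S t
    go fuel {S} {t} un bd R le with newNeighbour? S t
    ... | no none = inj₂ ([] , [] , [] , [] , λ { {z = z} (here refl) e → inj₁ (stay e) })
      where
      stay : ∀ {z} → E G t z → z ∈ S
      stay {z} e with z ∈? S
      ... | yes z∈ = z∈
      ... | no z∉ = contradiction (z , e , z∉) none
    go zero {S} un bd R le | yes (y , e , y∉) =
      contradiction (unique⇒length≤ (∉⇒All≢ y∉ ∷ un)) (<⇒≱ (s≤s (subst (n ≤_) (+-identityʳ _) bd)))
    go (suc fuel) {S} {t} {k} un bd R le | yes (y , e , y∉) with newNeighbour? (y ∷ S) t
    ... | yes (y′ , e′ , y′∉) = inj₁ (y′ ∷ y ∷ S , k , (y′ , here refl) , ∉⇒All≢ y′∉ ∷ ∉⇒All≢ y∉ ∷ un ,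
        branch R y∉ (y′∉ ∘ there) (y′∉ ∘ here) e e′ , bound)
      where
      bound : k + 9 ≤ 2 * (2 + length S)
      bound = begin
        k + 9               ≡⟨ +-assoc k 5 4 ⟨
        k + 5 + 4           ≤⟨ +-monoˡ-≤ 4 le ⟩
        2 * length S + 4    ≡⟨ +-comm (2 * length S) 4 ⟩
        4 + 2 * length S    ≡⟨ *-distribˡ-+ 2 2 (length S) ⟨
        2 * (2 + length S)  ∎
        where open ≤-Reasoning
    ... | no none with go fuel (∉⇒All≢ y∉ ∷ un) (subst (n ≤_) (+-suc _ fuel) bd) (lengthen R y∉ e)
                      (subst (2 + (k + 5) ≤_) (sym (*-suc 2 (length S))) (s≤s (s≤s le)))
    ...   | inj₁ s = inj₁ s
    ...   | inj₂ (ps , unp , off , ch , cl) =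
      inj₂ (y ∷ ps , All.map (λ q eq → q (here (sym eq))) off ∷ unp , y∉ ∷ All.map (λ q → q ∘ there) off , e ∷ ch , cl′)
      where
      -- The recursive call counts `y` among the old vertices, so a neighbour equal to `y` has to
      -- move over to the path.
      cl′ : ∀ {x z} → x ∈ t ∷ y ∷ ps → E G x z → z ∈ S ⊎ z ∈ y ∷ ps
      cl′ {z = z} (here refl) e′ with z ∈? (y ∷ S)
      ... | yes (here refl) = inj₂ (here refl)
      ... | yes (there z∈)  = inj₁ z∈
      ... | no z∉           = contradiction (z , e′ , z∉) none
      cl′ (there x∈) e′ with cl x∈ e′
      ... | inj₁ (here refl) = inj₂ (here refl)
      ... | inj₁ (there z∈)  = inj₁ z∈
      ... | inj₂ z∈          = inj₂ (there z∈)

-- Splitting and joining chains.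

chain-++⁻ˡ : ∀ {R : V → V → Set} xs {ys} → Chain R (xs ++ ys) → Chain R xs
chain-++⁻ˡ []           _        = []
chain-++⁻ˡ (x ∷ [])     _        = []
chain-++⁻ˡ (x ∷ y ∷ xs) (r ∷ ch) = r ∷ chain-++⁻ˡ (y ∷ xs) ch

chain-++⁻ʳ : ∀ {R : V → V → Set} xs {ys} → Chain R (xs ++ ys) → Chain R ys
chain-++⁻ʳ []                    ch       = ch
chain-++⁻ʳ (x ∷ []) {[]}         _        = []
chain-++⁻ʳ (x ∷ []) {_ ∷ _}      (_ ∷ ch) = ch
chain-++⁻ʳ (x ∷ y ∷ xs)          (_ ∷ ch) = chain-++⁻ʳ (y ∷ xs) ch

chain-join : ∀ {R : V → V → Set} xs {y ys} → Chain R (xs ++ y ∷ []) → Chain R (y ∷ ys) → Chain R (xs ++ y ∷ ys)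
chain-join []            _        ch = ch
chain-join (x ∷ [])      (r ∷ _)  ch = r ∷ ch
chain-join (x ∷ x′ ∷ xs) (r ∷ rs) ch = r ∷ chain-join (x′ ∷ xs) rs ch

chain-init : ∀ {R : V → V → Set} xs {y ys} → Chain R (xs ++ y ∷ ys) → Chain R (xs ++ y ∷ [])
chain-init xs {y} {ys} ch = chain-++⁻ˡ (xs ++ y ∷ []) (subst (Chain _) (sym (++-assoc xs (y ∷ []) ys)) ch)

pairs-∈ : ∀ {xs : List V} {x y} → (x , y) ∈ pairs xs → x ∈ xs × y ∈ xs
pairs-∈ {xs = a ∷ b ∷ r} (here refl) = here refl , there (here refl)
pairs-∈ {xs = a ∷ b ∷ r} (there p) with p , q ← pairs-∈ p = there p , there q

pairs-∈-tail : ∀ {xs : List V} {a x y} → (x , y) ∈ pairs (a ∷ xs) → y ∈ xs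
pairs-∈-tail {xs = b ∷ r} (here refl) = here refl
pairs-∈-tail {xs = b ∷ r} (there p)   = there (pairs-∈-tail p)

pairs-middle : ∀ (xs : List V) {x y ys} → (x , y) ∈ pairs (xs ++ x ∷ y ∷ ys)
pairs-middle []           = here refl
pairs-middle (a ∷ [])     = there (here refl)
pairs-middle (a ∷ b ∷ xs) = there (pairs-middle (b ∷ xs))

Unique-++⁻ʳ : ∀ (xs : List V) {ys} → Unique (xs ++ ys) → Unique ys
Unique-++⁻ʳ []       u       = u
Unique-++⁻ʳ (x ∷ xs) (_ ∷ u) = Unique-++⁻ʳ xs u

Unique-++⁻ˡ : ∀ (xs : List V) {ys} → Unique (xs ++ ys) → Unique xs
Unique-++⁻ˡ []       u       = []
Unique-++⁻ˡ (x ∷ xs) (p ∷ u) = All.++⁻ˡ xs p ∷ Unique-++⁻ˡ xs u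

two-members : ∀ {xs : List V} {x y} → x ∈ xs → y ∈ xs → x ≢ y →
  (∃₂ λ pre seg → ∃ λ post → xs ≡ pre ++ x ∷ seg ++ y ∷ post) ⊎
  (∃₂ λ pre seg → ∃ λ post → xs ≡ pre ++ y ∷ seg ++ x ∷ post)
two-members (here refl) (here refl) ne = contradiction refl ne
two-members (here refl) (there y∈)  ne with seg , post , refl ← ∈-∃++ y∈ = inj₁ ([] , seg , post , refl)
two-members (there x∈)  (here refl) ne with seg , post , refl ← ∈-∃++ x∈ = inj₂ ([] , seg , post , refl)
two-members {xs = a ∷ _} (there x∈)  (there y∈)  ne with two-members x∈ y∈ ne
... | inj₁ (pre , seg , post , refl) = inj₁ (a ∷ pre , seg , post , refl)
... | inj₂ (pre , seg , post , refl) = inj₂ (a ∷ pre , seg , post , refl)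

-- Ears, chords and the uniqueness of the cycle.

module _ {n : ℕ} (G : Graph n) where

  private
    Vx = Fin n

  cycEdge? : ∀ C x y → Dec (CycEdge G C x y)
  cycEdge? C x y = ((x , y) ∈ₚ? cedges G C) ⊎-dec ((y , x) ∈ₚ? cedges G C)
    where open DecMem (≡-dec (_≟_ {n}) (_≟_ {n})) using () renaming (_∈?_ to _∈ₚ?_)

  cycEdge-∈ : ∀ C {x y} → CycEdge G C x y → x ∈ cverts G C × y ∈ cverts G C
  cycEdge-∈ C = [ onCycle , Product.swap ∘ onCycle ]′
    where
    trim : ∀ {x} → x ∈ cverts G C ++ start C ∷ [] → x ∈ cverts G C
    trim {x} x∈ with ∈-++⁻ (cverts G C) x∈
    ... | inj₁ p           = p
    ... | inj₂ (here refl) = here refl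
    onCycle : ∀ {x y} → (x , y) ∈ cedges G C → x ∈ cverts G C × y ∈ cverts G C
    onCycle p with x∈ , y∈ ← pairs-∈ p = trim x∈ , trim y∈

  rotate : ∀ C {x} → x ∈ cverts G C → ∃ λ C′ → start C′ ≡ x × cverts G C ↭ cverts G C′
  rotate C x∈ with ∈-∃++ x∈
  ... | [] , post , refl = C , refl , ↭-refl
  ... | s ∷ pre , post , refl = C′ , refl , perm
    where
    x = _
    perm : s ∷ pre ++ x ∷ post ↭ x ∷ post ++ s ∷ pre
    perm = ++-comm (s ∷ pre) (x ∷ post)
    ch : Chain (E G) ((s ∷ pre) ++ x ∷ post ++ s ∷ [])
    ch = subst (Chain (E G)) (++-assoc (s ∷ pre) (x ∷ post) (s ∷ [])) (closed C)
    C′ : Cycle G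
    C′ = record
      { start  = x
      ; rest   = post ++ s ∷ pre
      ; long   = ≤-pred (subst (3 ≤_) (↭-length perm) (s≤s (long C)))
      ; uniq   = Unique-resp-↭ perm (uniq C)
      ; closed = subst (λ z → Chain (E G) (x ∷ z)) (sym (++-assoc post (s ∷ pre) (x ∷ [])))
                   (chain-join (x ∷ post) (chain-++⁻ʳ (s ∷ pre) ch) (chain-init (s ∷ pre) ch))
      }

  module UC (C : Cycle G) (uc : UniqueCycle G C) where

    offCycle⇒¬CycEdge : ∀ {x y} → y ∉ cverts G C → ¬ CycEdge G C x y
    offCycle⇒¬CycEdge y∉ ce = y∉ (proj₂ (cycEdge-∈ C ce))

    -- The path and the edge from `y` to `x` form a cycle, which has the same edges as `C`; in
    -- particular its first edge lies on `C`.
    close : ∀ {x s seg y} → Unique (x ∷ s ∷ seg ++ y ∷ []) → Chain (E G) (x ∷ s ∷ seg ++ y ∷ []) → E G y x →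
            CycEdge G C x s
    close {x} {s} {seg} {y} un ch e = proj₂ (uc D x s) (inj₁ (here refl))
      where
      D : Cycle G
      D = record
        { start  = x
        ; rest   = s ∷ seg ++ y ∷ []
        ; long   = s≤s (subst (1 ≤_) (sym (length-++ seg)) (m≤n+m 1 (length seg)))
        ; uniq   = un
        ; closed = subst (λ z → Chain (E G) (x ∷ s ∷ z)) (sym (++-assoc seg (y ∷ []) (x ∷ [])))
                     (chain-join (x ∷ s ∷ seg) ch (e ∷ []))
        }

    private
      to-rest : ∀ {x y : Vx} {ys} → y ∈ x ∷ ys → x ≢ y → y ∈ ys
      to-rest (here refl) ne = contradiction refl ne
      to-rest (there y∈)  ne = y∈

      Unique-replace : ∀ {x : Vx} {mid seg y post} → Unique (x ∷ seg ++ y ∷ post) → Unique mid →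
        All (_∉ (x ∷ seg ++ y ∷ post)) mid → Unique (x ∷ mid ++ y ∷ post)
      Unique-replace {x} {mid} {seg} {y} {post} (px ∷ u) um off =
        All.++⁺ (All.map (λ p eq → p (here (sym eq))) off) (All.++⁻ʳ seg px) ∷
        Unique.++⁺ um (Unique-++⁻ʳ seg u)
          (λ (p , q) → All.lookup off p (there (∈-++⁺ʳ seg q)))

    -- An ear attached to the cycle at x and y, completed by the arc from y to x, is a second cycle.
    no-ear : ∀ {x y m mid} → x ∈ cverts G C → y ∈ cverts G C → x ≢ y →
      Unique (m ∷ mid) → All (_∉ cverts G C) (m ∷ mid) → Chain (E G) (x ∷ m ∷ mid ++ y ∷ []) → ⊥
    no-ear {x} {y} {m} {mid} x∈ y∈ ne um (m∉ ∷ off) ch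
      with C′ , refl , perm ← rotate C x∈
      with seg , post , eq ← ∈-∃++ {A = Vx} (to-rest (∈-resp-↭ perm y∈) ne) =
      offCycle⇒¬CycEdge m∉ (proj₂ (uc D x m) (inj₁ (here refl)))
      where
      off′ : All (_∉ (x ∷ seg ++ y ∷ post)) (m ∷ mid)
      off′ = All.map (λ p q → p (∈-resp-↭ (↭-sym perm) (subst (λ z → _ ∈ x ∷ z) (sym eq) q))) (m∉ ∷ off)
      D : Cycle G
      D = record
        { start  = x
        ; rest   = m ∷ mid ++ y ∷ post
        ; long   = s≤s (subst (1 ≤_) (sym (length-++ mid)) (≤-trans (s≤s z≤n) (m≤n+m (suc (length post)) (length mid))))
        ; uniq   = Unique-replace {mid = m ∷ mid} {seg} (subst (λ z → Unique (x ∷ z)) eq (uniq C′)) um off′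
        ; closed = subst (λ z → Chain (E G) (x ∷ m ∷ z)) (sym (++-assoc mid (y ∷ post) (x ∷ [])))
            (chain-join (x ∷ m ∷ mid) ch
              (chain-++⁻ʳ (x ∷ seg) (subst (λ z → Chain (E G) (x ∷ z))
                (trans (cong (_++ x ∷ []) eq) (++-assoc seg (y ∷ post) (x ∷ []))) (closed C′))))
        }

    -- List the cycle from `x`. If `y` comes last, the edge is the closing one; otherwise the edge
    -- and the arc from `y` back to `x` form a cycle, whose edges are those of `C`.
    no-chord : ∀ {x y} → x ∈ cverts G C → y ∈ cverts G C → E G x y → CycEdge G C x y
    no-chord {x} {y} x∈ y∈ e
      with C′ , refl , perm ← rotate C x∈
      with ∈-∃++ {A = Vx} (to-rest (∈-resp-↭ perm y∈) (E⇒≢ G e))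
    ... | seg , [] , eq = proj₂ (uc C′ x y) (inj₂
            (subst (λ z → (y , x) ∈ pairs (x ∷ z ++ x ∷ [])) (sym eq)
              (subst (λ z → (y , x) ∈ pairs (x ∷ z)) (sym (++-assoc seg (y ∷ []) (x ∷ []))) (pairs-middle (x ∷ seg)))))
    ... | seg , p ∷ post , eq = proj₂ (uc D x y) (inj₁ (here refl))
      where
      D : Cycle G
      D = record
        { start  = x
        ; rest   = y ∷ p ∷ post
        ; long   = s≤s (s≤s z≤n)
        ; uniq   = Unique-replace {mid = []} {seg} (subst (λ z → Unique (x ∷ z)) eq (uniq C′)) [] []
        ; closed = e ∷ chain-++⁻ʳ (x ∷ seg) (subst (λ z → Chain (E G) (x ∷ z))
                (trans (cong (_++ x ∷ []) eq) (++-assoc seg (y ∷ p ∷ post) (x ∷ []))) (closed C′))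
        }

    shared-neighbour : ∀ {x y w} → x ∈ cverts G C → y ∈ cverts G C → x ≢ y → w ∉ cverts G C → E G x w → E G y w → ⊥
    shared-neighbour x∈ y∈ ne w∉ e e′ = no-ear x∈ y∈ ne ([] ∷ []) (w∉ ∷ []) (e ∷ E-sym G e′ ∷ [])

chain-reverse : ∀ {R : V → V → Set} → (∀ {a b} → R a b → R b a) → ∀ xs → Chain R xs → Chain R (reverse xs)
chain-reverse s []          _        = []
chain-reverse s (x ∷ [])    _        = []
chain-reverse s (x ∷ y ∷ r) (e ∷ ch) =
  subst (Chain _) (sym (trans (unfold-reverse x (y ∷ r)) (trans (cong (_++ x ∷ []) (unfold-reverse y r))
    (++-assoc (reverse r) (y ∷ []) (x ∷ [])))))
    (chain-join (reverse r) (subst (Chain _) (unfold-reverse y r) (chain-reverse s (y ∷ r) ch)) (s e ∷ []))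

reverse-∷-++ : ∀ (x : V) xs y → reverse (x ∷ xs ++ y ∷ []) ≡ y ∷ reverse xs ++ x ∷ []
reverse-∷-++ x xs y = trans (unfold-reverse x (xs ++ y ∷ [])) (cong (_++ x ∷ []) (reverse-++ xs (y ∷ [])))

chain⇒star : ∀ {R : V → V → Set} {u} xs {x} → Chain R (u ∷ xs) → x ∈ u ∷ xs → Star R u x
chain⇒star xs       _        (here refl) = ε
chain⇒star (y ∷ xs) (r ∷ ch) (there x∈)  = r ◅ chain⇒star xs ch x∈

pairs-pred : ∀ {u : V} {xs x} → x ∈ xs → ∃ λ y → (y , x) ∈ pairs (u ∷ xs)
pairs-pred {u = u} (here refl)       = u , here refl
pairs-pred {xs = y ∷ xs} (there x∈) with z , z∈ ← pairs-pred {u = y} x∈ = z , there z∈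

-- Upper bounds on distances, and trees that are stems.

module _ {n : ℕ} (G : Graph n) where

  private
    Vx = Fin n

  segment : ∀ pre {x : Vx} seg {y post} → Unique (pre ++ x ∷ seg ++ y ∷ post) → Chain (E G) (pre ++ x ∷ seg ++ y ∷ post) →
            IsPath G x seg y
  segment pre {x} seg {y} {post} un ch =
    Unique-++⁻ˡ (x ∷ seg ++ y ∷ []) (subst Unique (cong (x ∷_) (sym (++-assoc seg (y ∷ []) post))) (Unique-++⁻ʳ pre un)) ,
    chain-init (x ∷ seg) (chain-++⁻ʳ pre ch)

  IsPath-reverse : ∀ {u mid v} → IsPath G u mid v → IsPath G v (reverse mid) u
  IsPath-reverse {u} {mid} {v} (un , ch) =
    subst Unique (reverse-∷-++ u mid v) (Unique-resp-↭ (↭-sym (↭-reverse _)) un) ,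
    subst (Chain (E G)) (reverse-∷-++ u mid v) (chain-reverse (E-sym G) _ ch)

  segment-length : ∀ pre (x : Vx) seg y post {d} → length (pre ++ x ∷ seg ++ y ∷ post) ≤ suc d → suc (length seg) ≤ d
  segment-length pre x seg y post {d} le = ≤-pred (begin
    2 + length seg                                ≡⟨ cong suc (+-comm 1 (length seg)) ⟩
    suc (length seg + 1)                          ≤⟨ s≤s (+-monoʳ-≤ (length seg) (s≤s z≤n)) ⟩
    suc (length seg + length (y ∷ post))          ≡⟨ cong suc (length-++ seg) ⟨
    length (x ∷ seg ++ y ∷ post)                  ≤⟨ m≤n+m _ (length pre) ⟩
    length pre + length (x ∷ seg ++ y ∷ post)     ≡⟨ length-++ pre ⟨
    length (pre ++ x ∷ seg ++ y ∷ post)           ≤⟨ le ⟩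
    suc d                                         ∎)
    where open ≤-Reasoning

  path-DistLe : ∀ {L d} → Unique L → Chain (E G) L → length L ≤ suc d → ∀ {x y} → x ∈ L → y ∈ L → DistLe G x y d
  path-DistLe un ch le {x} {y} x∈ y∈ with x ≟ y
  ... | yes eq = inj₁ eq
  ... | no ne with two-members x∈ y∈ ne
  ...   | inj₁ (pre , seg , post , refl) =
    inj₂ (seg , segment pre seg un ch , segment-length pre x seg y post le)
  ...   | inj₂ (pre , seg , post , refl) =
    inj₂ (reverse seg , IsPath-reverse (segment pre seg un ch) ,
          subst (λ z → suc z ≤ _) (sym (length-reverse seg)) (segment-length pre y seg x post le))

  F-sym : ∀ C {x y} → F G C x y → F G C y x
  F-sym C (e , ¬c) = E-sym G e , λ c → ¬c (swap c)

  Nontrivial-at : ∀ C {x y} → F G C x y → Nontrivial G C x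
  Nontrivial-at C {x} {y} f = x , y , ε , (f ◅ ε) , f

  module Stem (C : Cycle G) (uc : UniqueCycle G C) where
    open UC G C uc

    -- A walk from `w` off the cycle edges is empty or starts with a non-cycle edge at `w`. Such an
    -- edge must leave the cycle, since every edge between cycle vertices lies on `C`.
    no-offNeighbour⇒trivial : ∀ {w} → w ∈ cverts G C → ¬ (∃ λ y → E G w y × y ∉ cverts G C) → ¬ Nontrivial G C w
    no-offNeighbour⇒trivial {w} w∈ none (x , y , wx , _ , f) with stays wx
      where
      noF : ∀ {y} → ¬ F G C w y
      noF {y} (e , ¬c) with y ∈? cverts G C
      ... | yes y∈ = ¬c (no-chord w∈ y∈ e)
      ... | no y∉  = none (y , e , y∉)
      stays : ∀ {x} → Star (F G C) w x → ¬ (∃ λ y → F G C x y)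
      stays ε       (y , f) = noF f
      stays (f ◅ _) _       = noF f
    ... | ¬f = ¬f (y , f)

    module Closed {u} (u∈ : u ∈ cverts G C) (cp : ClosedPath G (cverts G C) u) where

      ps : List Vx
      ps = proj₁ cp

      off : All (_∉ cverts G C) ps
      off = proj₁ (proj₂ (proj₂ cp))

      path : Chain (E G) (u ∷ ps)
      path = proj₁ (proj₂ (proj₂ (proj₂ cp)))

      closed-under : ∀ {x z} → x ∈ u ∷ ps → E G x z → z ∈ cverts G C ⊎ z ∈ ps
      closed-under = proj₂ (proj₂ (proj₂ (proj₂ cp)))

      unique : Unique (u ∷ ps)
      unique = All.map (λ p eq → p (subst (_∈ cverts G C) eq u∈)) off ∷ proj₁ (proj₂ cp)

      pathF : Chain (F G C) (u ∷ ps)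
      pathF = All.tabulate λ p∈ → All.lookup path p∈ , offCycle⇒¬CycEdge (All.lookup off (pairs-∈-tail p∈))

      -- Otherwise the stem from `u` to `x`, prolonged by the edge to `z`, is an ear between two
      -- cycle vertices.
      cycle-neighbour : ∀ {x z} → x ∈ ps → E G x z → z ∈ cverts G C → z ≡ u
      cycle-neighbour {x} {z} x∈ e z∈ with z ≟ u
      ... | yes eq = eq
      ... | no ne with pre , post , eq ← ∈-∃++ x∈ = ⊥-elim (ear pre eq)
        where
        ear : ∀ pre → ps ≡ pre ++ x ∷ post → ⊥
        ear [] eq = no-ear u∈ z∈ (≢-sym ne) ([] ∷ []) (All.lookup off x∈ ∷ [])
          (proj₁ (All.uncons (subst (λ l → Chain (E G) (u ∷ l)) eq path)) ∷ e ∷ [])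
        ear (p ∷ pre) eq = no-ear u∈ z∈ (≢-sym ne)
          (Unique-++⁻ˡ (p ∷ pre ++ x ∷ []) (subst Unique eq′ (AllPairs.tail unique)))
          (All.++⁻ˡ (p ∷ pre ++ x ∷ []) (subst (All _) eq′ off))
          (subst (λ l → Chain (E G) (u ∷ p ∷ l)) (sym (++-assoc pre (x ∷ []) (z ∷ [])))
            (chain-join (u ∷ p ∷ pre) (chain-init (u ∷ p ∷ pre) (subst (λ l → Chain (E G) (u ∷ l)) eq path)) (e ∷ [])))
          where
          eq′ : ps ≡ (p ∷ pre ++ x ∷ []) ++ post
          eq′ = trans eq (cong (p ∷_) (sym (++-assoc pre (x ∷ []) post)))

      -- An edge that skips stem vertices would close a cycle whose first edge ends off `C`.
      adjacent-before : ∀ pre {x} seg {z post} → u ∷ ps ≡ pre ++ x ∷ seg ++ z ∷ post → E G z x → (x , z) ∈ pairs (u ∷ ps)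
      adjacent-before pre []        eq e = subst (λ l → _ ∈ pairs l) (sym eq) (pairs-middle pre)
      adjacent-before pre {x} (s ∷ seg) eq e with un , ch ← segment pre (s ∷ seg) (subst Unique eq unique) (subst (Chain (E G)) eq path) =
        contradiction (proj₂ (cycEdge-∈ G C (close un ch e)))
          (All.lookup off (pairs-∈-tail (subst (λ l → (x , s) ∈ pairs l) (sym eq) (pairs-middle pre))))

      consecutive : ∀ {x z} → x ∈ u ∷ ps → z ∈ u ∷ ps → E G x z → (x , z) ∈ pairs (u ∷ ps) ⊎ (z , x) ∈ pairs (u ∷ ps)
      consecutive x∈ z∈ e with two-members x∈ z∈ (E⇒≢ G e)
      ... | inj₁ (pre , seg , post , eq) = inj₁ (adjacent-before pre seg eq (E-sym G e))
      ... | inj₂ (pre , seg , post , eq) = inj₂ (adjacent-before pre seg eq e)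

      neighbour : ∀ {x z} → x ∈ u ∷ ps → F G C x z → z ∈ u ∷ ps
      neighbour x∈ (e , ¬c) with closed-under x∈ e
      neighbour x∈          (e , ¬c) | inj₂ z∈ = there z∈
      neighbour (here refl) (e , ¬c) | inj₁ z∈ = contradiction (no-chord u∈ z∈ e) ¬c
      neighbour (there x∈)  (e , ¬c) | inj₁ z∈ = here (cycle-neighbour x∈ e z∈)

      tree⇒path : ∀ {x y} → x ∈ u ∷ ps → Star (F G C) x y → y ∈ u ∷ ps
      tree⇒path x∈ ε       = x∈
      tree⇒path x∈ (f ◅ s) = tree⇒path (neighbour x∈ f) s

      path⇒tree : ∀ {x} → x ∈ u ∷ ps → InTree G C u x
      path⇒tree = chain⇒star ps pathF

      pathTree : ps ≢ [] → PathTreeFrom G C u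
      pathTree ne = ps , ne , unique , pathF ,
        (λ x → tree⇒path (here refl) , path⇒tree) ,
        (λ x y t f → let x∈ = tree⇒path (here refl) t in consecutive x∈ (neighbour x∈ f) (proj₁ f))

      nonempty : (∃ λ y → E G u y × y ∉ cverts G C) → ps ≢ []
      nonempty (y , e , y∉) eq with closed-under (here refl) e
      ... | inj₁ y∈ = y∉ y∈
      ... | inj₂ y∈ with () ← subst (y ∈_) eq y∈

-- Lower bounds on distances in a hexagon with two opposite stems.

module _ {n : ℕ} where

  -- For a repetition-free stem this is the number of steps from its root, and 0 for every vertex
  -- off the stem.
  depth : List (Fin n) → Fin n → ℕ
  depth []       x = 0
  depth (p ∷ ps) x with x ∈? (p ∷ ps)
  ... | yes _ = suc (depth ps x)
  ... | no  _ = 0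

  depth-∉ : ∀ {ps x} → x ∉ ps → depth ps x ≡ 0
  depth-∉ {[]}     _  = refl
  depth-∉ {p ∷ ps} {x} x∉ with x ∈? (p ∷ ps)
  ... | yes x∈ = contradiction x∈ x∉
  ... | no  _  = refl

  depth-∈ : ∀ {p ps x} → x ∈ p ∷ ps → depth (p ∷ ps) x ≡ suc (depth ps x)
  depth-∈ {p} {ps} {x} x∈ with x ∈? (p ∷ ps)
  ... | yes _  = refl
  ... | no x∉  = contradiction x∈ x∉

  depth-pairs : ∀ {u ps x y} → Unique (u ∷ ps) → (x , y) ∈ pairs (u ∷ ps) → depth ps y ≡ suc (depth ps x)
  depth-pairs {ps = p ∷ ps} un@(_ ∷ un′) (here refl) =
    trans (trans (depth-∈ (here refl)) (cong suc (depth-∉ (Unique.Unique[x∷xs]⇒x∉xs un′))))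
      (cong suc (sym (depth-∉ (Unique.Unique[x∷xs]⇒x∉xs un))))
  depth-pairs {ps = p ∷ ps} (_ ∷ un) (there q) =
    trans (depth-∈ (proj₂ (pairs-∈ q))) (trans (cong suc (depth-pairs un q)) (cong suc (sym (depth-∈ (proj₁ (pairs-∈ q))))))

  tip : Fin n → List (Fin n) → Fin n
  tip u []       = u
  tip u (p ∷ ps) = tip p ps

  tip∈ : ∀ u ps → tip u ps ∈ u ∷ ps
  tip∈ u []       = here refl
  tip∈ u (p ∷ ps) = there (tip∈ p ps)

  depth-tip : ∀ u ps → Unique (u ∷ ps) → depth ps (tip u ps) ≡ length ps
  depth-tip u []       _        = refl
  depth-tip u (p ∷ ps) (_ ∷ un) = trans (depth-∈ (tip∈ p ps)) (cong suc (depth-tip p ps un))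

Within1 : ℕ → ℕ → Set
Within1 a b = a ≤ suc b × b ≤ suc a

module _ {n : ℕ} (G : Graph n) where

  private
    Vx = Fin n

  Lipschitz : (Vx → ℕ) → Set
  Lipschitz f = ∀ {x y} → E G x y → f y ≤ suc (f x)

  lipschitz-path : ∀ {f} → Lipschitz f → ∀ x mid y → Chain (E G) (x ∷ mid ++ y ∷ []) → f y ≤ suc (length mid) + f x
  lipschitz-path L x []        y (e ∷ _)  = L e
  lipschitz-path {f} L x (w ∷ mid) y (e ∷ ch) = begin
    f y                          ≤⟨ lipschitz-path L w mid y ch ⟩
    suc (length mid) + f w       ≤⟨ +-monoʳ-≤ (suc (length mid)) (L e) ⟩
    suc (length mid) + suc (f x) ≡⟨ +-suc (suc (length mid)) (f x) ⟩
    suc (suc (length mid)) + f x ∎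
    where open ≤-Reasoning

  -- Bounds a distance from below by one potential function, without any inspection of the possible
  -- paths.
  lipschitz-dist : ∀ {f} → Lipschitz f → ∀ {x y k} → DistLe G x y k → f y ≤ k + f x
  lipschitz-dist L {k = k} (inj₁ refl) = m≤n+m _ k
  lipschitz-dist {f} L {x} {y} (inj₂ (mid , (_ , ch) , le)) = ≤-trans (lipschitz-path L x mid y ch) (+-monoˡ-≤ (f x) le)

  -- A hexagon with (possibly empty) paths ps and qs hanging from the opposite vertices a₀ and a₃.
  module Spine (cn : Connected G) (a₀ a₁ a₂ a₃ a₄ a₅ : Vx) (ps qs : List Vx) where

    hexagon : List Vx
    hexagon = a₀ ∷ a₁ ∷ a₂ ∷ a₃ ∷ a₄ ∷ a₅ ∷ []

    vertices : List Vx
    vertices = hexagon ++ ps ++ qs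

    Listed : List Vx → Vx → Vx → Set
    Listed L x y = (x , y) ∈ pairs L ⊎ (y , x) ∈ pairs L

    module _ (un : Unique vertices)
      (edges : ∀ {x y} → x ∈ vertices → E G x y →
        Listed (hexagon ++ a₀ ∷ []) x y ⊎ Listed (a₀ ∷ ps) x y ⊎ Listed (a₃ ∷ qs) x y) where

      private
        un-hex : Unique hexagon
        un-hex = Unique-++⁻ˡ hexagon un

        disjoint : ∀ xs {ys : List Vx} → Unique (xs ++ ys) → ∀ {x} → x ∈ xs → x ∉ ys
        disjoint (x ∷ xs) (p ∷ _) (here refl) x∈ = All.lookup (All.++⁻ʳ xs p) x∈ refl
        disjoint (x ∷ xs) (_ ∷ u) (there x∈)  y∈ = disjoint xs u x∈ y∈

        hex∉ : ∀ {x} → x ∈ hexagon → x ∉ ps × x ∉ qs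
        hex∉ x∈ = (λ p → disjoint hexagon un x∈ (∈-++⁺ˡ p)) , (λ p → disjoint hexagon un x∈ (∈-++⁺ʳ ps p))

        ps∉qs : ∀ {x} → x ∈ ps → x ∉ qs
        ps∉qs = disjoint ps (Unique-++⁻ʳ hexagon un)

        unP : Unique (a₀ ∷ ps)
        unP = All.tabulate (λ p eq → proj₁ (hex∉ (here refl)) (subst (_∈ ps) (sym eq) p))
              ∷ Unique-++⁻ˡ ps (Unique-++⁻ʳ hexagon un)

        unQ : Unique (a₃ ∷ qs)
        unQ = All.tabulate (λ p eq → proj₂ (hex∉ (there (there (there (here refl))))) (subst (_∈ qs) (sym eq) p))
              ∷ Unique-++⁻ʳ ps (Unique-++⁻ʳ hexagon un)

        hexEdge-∈ : ∀ {x y} → (x , y) ∈ pairs (hexagon ++ a₀ ∷ []) → x ∈ hexagon × y ∈ hexagon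
        hexEdge-∈ p with x∈ , y∈ ← pairs-∈ p = trim x∈ , trim y∈
          where
          trim : ∀ {x} → x ∈ hexagon ++ a₀ ∷ [] → x ∈ hexagon
          trim x∈ with ∈-++⁻ hexagon x∈
          ... | inj₁ p           = p
          ... | inj₂ (here refl) = here refl

        onP : ∀ {x} → x ∈ a₀ ∷ ps → x ∈ vertices
        onP (here refl) = here refl
        onP (there x∈)  = ∈-++⁺ʳ hexagon (∈-++⁺ˡ x∈)

        onQ : ∀ {x} → x ∈ a₃ ∷ qs → x ∈ vertices
        onQ (here refl) = there (there (there (here refl)))
        onQ (there x∈)  = ∈-++⁺ʳ hexagon (∈-++⁺ʳ ps x∈)

        target : ∀ {x y} → Listed (hexagon ++ a₀ ∷ []) x y ⊎ Listed (a₀ ∷ ps) x y ⊎ Listed (a₃ ∷ qs) x y → y ∈ vertices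
        target (inj₁ (inj₁ p))        = ∈-++⁺ˡ (proj₂ (hexEdge-∈ p))
        target (inj₁ (inj₂ p))        = ∈-++⁺ˡ (proj₁ (hexEdge-∈ p))
        target (inj₂ (inj₁ (inj₁ p))) = onP (proj₂ (pairs-∈ p))
        target (inj₂ (inj₁ (inj₂ p))) = onP (proj₁ (pairs-∈ p))
        target (inj₂ (inj₂ (inj₁ p))) = onQ (proj₂ (pairs-∈ p))
        target (inj₂ (inj₂ (inj₂ p))) = onQ (proj₁ (pairs-∈ p))

      -- The list is closed under adjacency by `edges`, and `G` is connected.
      covers : ∀ v → v ∈ vertices
      covers v = go (here refl) (cn a₀ v)
        where
        go : ∀ {x y} → x ∈ vertices → Star (E G) x y → y ∈ vertices
        go x∈ ε       = x∈
        go x∈ (e ◅ s) = go (target (edges x∈ e)) s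

      order : n ≡ 6 + (length ps + length qs)
      order = trans (≤-antisym (covering⇒≤length covers) (unique⇒length≤ un)) (cong (6 +_) (length-++ ps))

      private
        -- The distance from `a₀` around the hexagon, continued constantly along the stems. On `ps`
        -- the position is 6, beyond the table, and the default 0 of `nth` is the right value; `qs`
        -- needs the explicit 3.
        base : Vx → ℕ
        base x with x ∈? qs
        ... | yes _ = 3
        ... | no  _ = nth 0 (0 ∷ 1 ∷ 2 ∷ 3 ∷ 2 ∷ 1 ∷ []) (position hexagon x)

        -- The distance from the tip of ps.
        height : Vx → ℕ
        height x = base x + depth qs x + (length ps ∸ depth ps x)

        position-∉ : ∀ {xs : List Vx} {x} → x ∉ xs → position xs x ≡ length xs
        position-∉ {[]}     x∉ = refl
        position-∉ {y ∷ xs} {x} x∉ with x ≟ y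
        ... | yes eq = contradiction (here eq) x∉
        ... | no  _  = cong suc (position-∉ (x∉ ∘ there))

        base-∉ : ∀ {x} → x ∉ qs → base x ≡ nth 0 (0 ∷ 1 ∷ 2 ∷ 3 ∷ 2 ∷ 1 ∷ []) (position hexagon x)
        base-∉ {x} x∉ with x ∈? qs
        ... | yes x∈ = contradiction x∈ x∉
        ... | no  _  = refl

        base-hex : ∀ i → i < 6 → base (nth a₀ hexagon i) ≡ nth 0 (0 ∷ 1 ∷ 2 ∷ 3 ∷ 2 ∷ 1 ∷ []) i
        base-hex i i<6 = trans (base-∉ (proj₂ (hex∉ (nth∈ a₀ hexagon i<6))))
          (cong (nth 0 (0 ∷ 1 ∷ 2 ∷ 3 ∷ 2 ∷ 1 ∷ [])) (position-nth a₀ un-hex i<6))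

        base-P : ∀ {x} → x ∈ a₀ ∷ ps → base x ≡ 0
        base-P (here refl) = base-hex 0 (s≤s z≤n)
        base-P (there x∈)  = trans (base-∉ (ps∉qs x∈))
          (cong (nth 0 (0 ∷ 1 ∷ 2 ∷ 3 ∷ 2 ∷ 1 ∷ [])) (position-∉ (λ h → proj₁ (hex∉ h) x∈)))

        base-Q : ∀ {x} → x ∈ a₃ ∷ qs → base x ≡ 3
        base-Q (here refl) = base-hex 3 (s≤s (s≤s (s≤s (s≤s z≤n))))
        base-Q {x} (there x∈) with x ∈? qs
        ... | yes _ = refl
        ... | no x∉ = contradiction x∈ x∉

        ∉qs-P : ∀ {x} → x ∈ a₀ ∷ ps → depth qs x ≡ 0
        ∉qs-P (here refl) = depth-∉ (proj₂ (hex∉ (here refl)))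
        ∉qs-P (there x∈)  = depth-∉ (ps∉qs x∈)

        ∉ps-Q : ∀ {x} → x ∈ a₃ ∷ qs → depth ps x ≡ 0
        ∉ps-Q (here refl) = depth-∉ (proj₁ (hex∉ (there (there (there (here refl))))))
        ∉ps-Q (there x∈)  = depth-∉ (λ p → ps∉qs p x∈)

        height-hex : ∀ {x} → x ∈ hexagon → height x ≡ base x + length ps
        height-hex {x} x∈ = cong₂ (λ s t → s + (length ps ∸ t))
          (trans (cong (base x +_) (depth-∉ (proj₂ (hex∉ x∈)))) (+-identityʳ (base x)))
          (depth-∉ (proj₁ (hex∉ x∈)))

        height-P : ∀ {x} → x ∈ a₀ ∷ ps → height x ≡ length ps ∸ depth ps x
        height-P {x} x∈ = cong₂ (λ s t → s + t + (length ps ∸ depth ps x)) (base-P x∈) (∉qs-P x∈)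

        height-Q : ∀ {x} → x ∈ a₃ ∷ qs → height x ≡ 3 + depth qs x + length ps
        height-Q {x} x∈ = cong₂ (λ s t → s + depth qs x + (length ps ∸ t)) (base-Q x∈) (∉ps-Q x∈)

        hex-close : ∀ {x y} → (x , y) ∈ pairs (hexagon ++ a₀ ∷ []) → Within1 (base x) (base y)
        hex-close p = All.lookup table p
          where
          b : ∀ i → {i<6 : True (i ℕ.<? 6)} → base (nth a₀ hexagon i) ≡ nth 0 (0 ∷ 1 ∷ 2 ∷ 3 ∷ 2 ∷ 1 ∷ []) i
          b i {i<6} = base-hex i (toWitness i<6)
          ok : ∀ {x y s t} → base x ≡ s → base y ≡ t → {True ((s ℕ.≤? suc t) ×-dec (t ℕ.≤? suc s))} → Within1 (base x) (base y)
          ok refl refl {w} = toWitness w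
          table : All (λ p → Within1 (base (proj₁ p)) (base (proj₂ p))) (pairs (hexagon ++ a₀ ∷ []))
          table = ok (b 0) (b 1) ∷ ok (b 1) (b 2) ∷ ok (b 2) (b 3) ∷ ok (b 3) (b 4) ∷ ok (b 4) (b 5) ∷ ok (b 5) (b 0) ∷ []

        near-hex : ∀ {x y} → (x , y) ∈ pairs (hexagon ++ a₀ ∷ []) → Within1 (height x) (height y)
        near-hex p with x∈ , y∈ ← hexEdge-∈ p | l , r ← hex-close p =
          subst₂ Within1 (sym (height-hex x∈)) (sym (height-hex y∈)) (+-monoˡ-≤ (length ps) l , +-monoˡ-≤ (length ps) r)

        near-P : ∀ {x y} → (x , y) ∈ pairs (a₀ ∷ ps) → Within1 (height x) (height y)
        near-P {x} {y} p with x∈ , y∈ ← pairs-∈ p =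
          subst₂ Within1 (sym (height-P x∈)) (sym (trans (height-P y∈) (cong (length ps ∸_) (depth-pairs unP p))))
            (close (length ps) (depth ps x))
          where
          close : ∀ m d → Within1 (m ∸ d) (m ∸ suc d)
          close zero    zero    = z≤n , z≤n
          close zero    (suc d) = z≤n , z≤n
          close (suc m) zero    = ≤-refl , m≤n+m m 2
          close (suc m) (suc d) = close m d

        near-Q : ∀ {x y} → (x , y) ∈ pairs (a₃ ∷ qs) → Within1 (height x) (height y)
        near-Q {x} {y} p with x∈ , y∈ ← pairs-∈ p =
          subst₂ Within1 (sym (height-Q x∈))
            (sym (trans (height-Q y∈) (cong (λ z → 3 + z + length ps) (depth-pairs unQ p))))
            (m≤n+m _ 2 , ≤-refl)

        lipschitz : Lipschitz height
        lipschitz e with edges (covers _) e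
        ... | inj₁ (inj₁ p)        = proj₂ (near-hex p)
        ... | inj₁ (inj₂ p)        = proj₁ (near-hex p)
        ... | inj₂ (inj₁ (inj₁ p)) = proj₂ (near-P p)
        ... | inj₂ (inj₁ (inj₂ p)) = proj₁ (near-P p)
        ... | inj₂ (inj₂ (inj₁ p)) = proj₂ (near-Q p)
        ... | inj₂ (inj₂ (inj₂ p)) = proj₁ (near-Q p)

      -- The tips have heights 0 and 3 + |ps| + |qs|, a difference of n - 3 by `order`. An empty
      -- stem has its tip on the hexagon.
      far-apart : ∀ {k} → DistLe G (tip a₀ ps) (tip a₃ qs) k → 3 + (length ps + length qs) ≤ k
      far-apart {k} dl = begin
        3 + (length ps + length qs)          ≡⟨ cong (3 +_) (+-comm (length ps) (length qs)) ⟩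
        3 + length qs + length ps            ≡⟨ cong (λ z → 3 + z + length ps) (depth-tip a₃ qs unQ) ⟨
        3 + depth qs (tip a₃ qs) + length ps ≡⟨ height-Q (tip∈ a₃ qs) ⟨
        height (tip a₃ qs)                   ≤⟨ lipschitz-dist lipschitz dl ⟩
        k + height (tip a₀ ps)               ≡⟨ cong (k +_) (height-P (tip∈ a₀ ps)) ⟩
        k + (length ps ∸ depth ps (tip a₀ ps)) ≡⟨ cong (λ z → k + (length ps ∸ z)) (depth-tip a₀ ps unP) ⟩
        k + (length ps ∸ length ps)          ≡⟨ cong (k +_) (n∸n≡0 (length ps)) ⟩
        k + 0                                ≡⟨ +-identityʳ k ⟩
        k                                    ∎
        where open ≤-Reasoning

-- Colours forced by distance, and the subgraphs that save.

length-pairs : ∀ (x : V) mid y → length (pairs (x ∷ mid ++ y ∷ [])) ≡ suc (length mid)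
length-pairs x []        y = refl
length-pairs x (w ∷ mid) y = cong suc (length-pairs w mid y)

module _ {n : ℕ} (G : Graph n) where

  private
    Vx = Fin n

  TRC-mono : ∀ {k l} → k ≤ l → TRCColorable G k → TRCColorable G l
  TRC-mono k≤l (c , rc) = c′ , λ u v ne → let mid , p , un = rc u v ne in
      mid , p , subst Unique (colours≡ u mid v) (Unique.map⁺ (inject≤-injective k≤l k≤l _ _) un)
    where
    c′ : TotalColoring G _
    c′ = record
      { vcol     = λ v → inject≤ (vcol c v) k≤l
      ; ecol     = λ u v → inject≤ (ecol c u v) k≤l
      ; ecol-sym = λ u v → cong (λ z → inject≤ z k≤l) (ecol-sym c u v)
      }
    colours≡ : ∀ u mid v → map (λ z → inject≤ z k≤l) (pathColors G c u mid v) ≡ pathColors G c′ u mid v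
    colours≡ u mid v = trans (map-++ _ (map _ (pairs (pathVerts G u mid v))) (map _ mid))
      (cong₂ _++_ (sym (map-∘ (pairs (pathVerts G u mid v)))) (sym (map-∘ mid)))

  distance-bound : ∀ {a b d k} → 0 < d → (∀ {j} → DistLe G a b j → d ≤ j) → TRCColorable G k → d + d ≤ suc k
  distance-bound {a} {b} {d} {k} 0<d far (c , rc)
    -- A path is supplied only for distinct ends; `0 < d` guarantees this.
    with mid , p , un ← rc a b (λ eq → <⇒≱ 0<d (far (inj₁ eq))) = begin
    d + d                                          ≤⟨ +-mono-≤ d≤ d≤ ⟩
    suc (length mid) + suc (length mid)            ≡⟨ +-suc (suc (length mid)) (length mid) ⟩
    suc (suc (length mid) + length mid)            ≡⟨ cong suc (sym size) ⟩
    suc (length (pathColors G c a mid b))          ≤⟨ s≤s (unique⇒length≤ un) ⟩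
    suc k                                          ∎
    where
    open ≤-Reasoning
    d≤ : d ≤ suc (length mid)
    d≤ = far (inj₂ (mid , p , ≤-refl))
    size : length (pathColors G c a mid b) ≡ suc (length mid) + length mid
    size = trans (length-++ (map _ (pairs (pathVerts G a mid b))))
      (cong₂ _+_ (trans (length-map _ (pairs (pathVerts G a mid b))) (length-pairs a mid b)) (length-map _ mid))

  FarApart : ℕ → Set
  FarApart d = ∃₂ λ a b → ∀ {j} → DistLe G a b j → d ≤ j

  HasDiam⇒FarApart : ∀ {d} → HasDiam G d → FarApart d
  HasDiam⇒FarApart {d} (_ , a , b , far) = a , b , λ {j} dl → ≮⇒≥ (λ j<d → far j j<d dl)

  -- The bounds meet because 2(3 + d) - 7 = 2d - 1.
  exact-trc : ∀ {d} → n ≡ 3 + d → 0 < d → FarApart d → (∃ λ l → l + 7 ≤ 2 * n × TRCColorable G l) → TrcIs G (2 * n ∸ 7)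
  exact-trc {d} n≡ 0<d (_ , _ , far) (l , l+7≤ , trc) =
    TRC-mono (m+n≤o⇒m≤o∸n l l+7≤) trc ,
    λ k k< trc-k → <⇒≱ k< (begin
      2 * n ∸ 7             ≡⟨ cong (λ z → 2 * z ∸ 7) n≡ ⟩
      2 * (3 + d) ∸ 7       ≡⟨ cong (_∸ 7) (*-distribˡ-+ 2 3 d) ⟩
      2 * d ∸ 1             ≡⟨ cong (λ z → d + z ∸ 1) (+-identityʳ d) ⟩
      d + d ∸ 1             ≤⟨ ∸-monoˡ-≤ 1 (distance-bound 0<d far trc-k) ⟩
      k                     ∎)
    where open ≤-Reasoning

  record Hexagon (a₀ a₁ a₂ a₃ a₄ a₅ : Vx) : Set where
    constructor hex
    field
      distinct : Unique (a₀ ∷ a₁ ∷ a₂ ∷ a₃ ∷ a₄ ∷ a₅ ∷ [])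
      e₀₁ : E G a₀ a₁
      e₁₂ : E G a₁ a₂
      e₂₃ : E G a₂ a₃
      e₃₄ : E G a₃ a₄
      e₄₅ : E G a₄ a₅
      e₅₀ : E G a₅ a₀

  turn : ∀ {a₀ a₁ a₂ a₃ a₄ a₅} → Hexagon a₀ a₁ a₂ a₃ a₄ a₅ → Hexagon a₅ a₀ a₁ a₂ a₃ a₄
  turn {a₀} {a₁} {a₂} {a₃} {a₄} {a₅} (hex un e₀₁ e₁₂ e₂₃ e₃₄ e₄₅ e₅₀) =
    hex (Unique-resp-↭ (++-comm (a₀ ∷ a₁ ∷ a₂ ∷ a₃ ∷ a₄ ∷ []) (a₅ ∷ [])) un) e₅₀ e₀₁ e₁₂ e₂₃ e₃₄ e₄₅

  module _ {a₀ a₁ a₂ a₃ a₄ a₅} (H : Hexagon a₀ a₁ a₂ a₃ a₄ a₅) where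
    open Hexagon H

    private
      six : List Vx
      six = a₀ ∷ a₁ ∷ a₂ ∷ a₃ ∷ a₄ ∷ a₅ ∷ []

      add₂ : ∀ {x y} → x ∉ six → y ∉ six → x ≢ y → Unique (six ++ x ∷ y ∷ [])
      add₂ x∉ y∉ x≢y = Unique.++⁺ distinct ((x≢y ∷ []) ∷ [] ∷ [])
        λ { (v∈ , here refl) → x∉ v∈ ; (v∈ , there (here refl)) → y∉ v∈ }

    hexagon-saving : Saving G 7
    hexagon-saving = six , 5 , (a₀ , here refl) , distinct ,
      C₆.Realise.colouring C₆-valid G a₀ six refl distinct
        (e₀₁ ∷ e₁₂ ∷ e₂₃ ∷ e₃₄ ∷ e₄₅ ∷ E-sym G e₅₀ ∷ []) , ≤-refl

    adjacentLeaves : ∀ {x y} → x ∉ six → y ∉ six → x ≢ y → E G a₀ x → E G a₁ y → Saving G 9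
    adjacentLeaves x∉ y∉ x≢y ex ey = six ++ _ , 7 , (a₀ , here refl) , un ,
      AdjacentLeaves.Realise.colouring AdjacentLeaves-valid G a₀ _ refl un
        (e₀₁ ∷ e₁₂ ∷ e₂₃ ∷ e₃₄ ∷ e₄₅ ∷ E-sym G e₅₀ ∷ ex ∷ ey ∷ []) , ≤-refl
      where un = add₂ x∉ y∉ x≢y

    spacedLeaves : ∀ {x y} → x ∉ six → y ∉ six → x ≢ y → E G a₀ x → E G a₂ y → Saving G 9
    spacedLeaves x∉ y∉ x≢y ex ey = six ++ _ , 7 , (a₀ , here refl) , un ,
      SpacedLeaves.Realise.colouring SpacedLeaves-valid G a₀ _ refl un
        (e₀₁ ∷ e₁₂ ∷ e₂₃ ∷ e₃₄ ∷ e₄₅ ∷ E-sym G e₅₀ ∷ ex ∷ ey ∷ []) , ≤-refl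
      where un = add₂ x∉ y∉ x≢y

    rootedHexagon : RootedColouring G six a₀ 7
    rootedHexagon = record
      { colouring = R.colouring
      ; r∈        = here refl
      ; α≢β       = λ ()
      ; α<k       = s≤s (s≤s (s≤s z≤n))
      ; β<k       = ≤-refl
      ; rootedα   = R.rooted RootedC₆-rooted₂ (s≤s z≤n)
      ; rootedβ   = R.rooted RootedC₆-rooted₆ (s≤s z≤n)
      }
      where
      module R = RootedC₆.Realise RootedC₆-valid G a₀ six refl distinct
        (e₀₁ ∷ e₁₂ ∷ e₂₃ ∷ e₃₄ ∷ e₄₅ ∷ E-sym G e₅₀ ∷ [])

    exploreFrom : Saving G 9 ⊎ ClosedPath G six a₀
    -- The reserved start saves 5: 7 + 5 = 2 · 6.
    exploreFrom = explore G distinct rootedHexagon ≤-refl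

    hexagon-path : ∀ {x y} → x ∈ six → y ∈ six → DistLe G x y 5
    hexagon-path = path-DistLe G distinct (e₀₁ ∷ e₁₂ ∷ e₂₃ ∷ e₃₄ ∷ e₄₅ ∷ []) ≤-refl

  ClosedPath-resp : ∀ {S T t} → S ↭ T → ClosedPath G S t → ClosedPath G T t
  ClosedPath-resp p (ps , un , off , ch , cl) =
    ps , un , All.map (λ q → q ∘ ∈-resp-↭ (↭-sym p)) off , ch , λ x∈ e → Sum.map₁ (∈-resp-↭ p) (cl x∈ e)

  B6At : Cycle G → Vx → Set
  B6At C u = u ∈ cverts G C × PathTreeFrom G C u × (∀ w → w ∈ cverts G C → w ≢ u → ¬ Nontrivial G C w)

  -- The families are defined relative to a listing of the cycle, but depend only on its edges, its
  -- vertex set and its length.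
  module Transfer {C C′ : Cycle G} (sc : SameCycle G C C′) (perm : cverts G C ↭ cverts G C′) where

    F→ : ∀ {x y} → F G C x y → F G C′ x y
    F→ {x} {y} (e , ¬c) = e , λ c → ¬c (proj₂ (sc x y) c)

    F← : ∀ {x y} → F G C′ x y → F G C x y
    F← {x} {y} (e , ¬c) = e , λ c → ¬c (proj₁ (sc x y) c)

    nontrivial : ∀ {u} → Nontrivial G C u → Nontrivial G C′ u
    nontrivial (x , y , p , q , f) = x , y , Star.map F→ p , Star.map F→ q , F→ f

    nontrivial← : ∀ {u} → Nontrivial G C′ u → Nontrivial G C u
    nontrivial← (x , y , p , q , f) = x , y , Star.map F← p , Star.map F← q , F← f

    to : ∀ {x} → x ∈ cverts G C → x ∈ cverts G C′
    to = ∈-resp-↭ perm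

    from : ∀ {x} → x ∈ cverts G C′ → x ∈ cverts G C
    from = ∈-resp-↭ (↭-sym perm)

    b6At : ∀ {u} → B6At C u → B6At C′ u
    b6At (u∈ , (ps , ne , un , ch , tr , ed) , triv) =
      to u∈ ,
      (ps , ne , un , All.map F→ ch ,
        (λ x → proj₁ (tr x) ∘ Star.map F← , Star.map F→ ∘ proj₂ (tr x)) ,
        (λ x y t f → ed x y (Star.map F← t) (F← f))) ,
      λ w w∈ ne nt → triv w (from w∈) ne (nontrivial← nt)

    inB6 : InB6 G C → InB6 G C′
    inB6 (six , u , b) = trans (sym (↭-length perm)) six , u , b6At b

    inJ1 : InJ1 G C → InJ1 G C′
    inJ1 (six , (u , v , u∈ , v∈ , ne , nu , nv , only) , diam) =
      trans (sym (↭-length perm)) six ,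
      (u , v , to u∈ , to v∈ , ne , nontrivial nu , nontrivial nv , λ w w∈ nt → only w (from w∈) (nontrivial← nt)) ,
      diam

  UniqueCycle-resp : ∀ {C} C′ → UniqueCycle G C → UniqueCycle G C′
  UniqueCycle-resp C′ uc D x y =
    (λ c → proj₁ (uc D x y) (proj₂ (uc C′ x y) c)) , (λ c → proj₁ (uc C′ x y) (proj₂ (uc D x y) c))

  SameCycle-sym : ∀ {C C′} → SameCycle G C C′ → SameCycle G C′ C
  SameCycle-sym sc x y = proj₂ (sc x y) , proj₁ (sc x y)

  hexagon-saves-7 : ∀ C → cycLength G C ≡ 6 → Saving G 7
  hexagon-saves-7 record { rest = _ ∷ _ ∷ _ ∷ _ ∷ _ ∷ [] ; uniq = un ; closed = e₀ ∷ e₁ ∷ e₂ ∷ e₃ ∷ e₄ ∷ e₅ ∷ [] } refl =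
    hexagon-saving (hex un e₀ e₁ e₂ e₃ e₄ e₅)

  heptagon-saves-9 : ∀ C → cycLength G C ≡ 7 → (∃ λ y → E G (start C) y × y ∉ cverts G C) → Saving G 9
  heptagon-saves-9 record { start = s ; rest = r@(_ ∷ _ ∷ _ ∷ _ ∷ _ ∷ _ ∷ []) ; uniq = un
                          ; closed = e₀ ∷ e₁ ∷ e₂ ∷ e₃ ∷ e₄ ∷ e₅ ∷ e₆ ∷ [] } refl (y , e , y∉) =
    (s ∷ r) ++ y ∷ [] , 7 , (s , here refl) , un′ ,
    C₇₊₁.Realise.colouring C₇₊₁-valid G s _ refl un′
      (e₀ ∷ e₁ ∷ e₂ ∷ e₃ ∷ e₄ ∷ e₅ ∷ E-sym G e₆ ∷ e ∷ []) , ≤-refl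
    where un′ = Unique.++⁺ un ([] ∷ []) λ { (v∈ , here refl) → y∉ v∈ }

  octagon-saves-9 : ∀ C → cycLength G C ≡ 8 → Saving G 9
  octagon-saves-9 record { start = s ; rest = r@(_ ∷ _ ∷ _ ∷ _ ∷ _ ∷ _ ∷ _ ∷ []) ; uniq = un
                         ; closed = e₀ ∷ e₁ ∷ e₂ ∷ e₃ ∷ e₄ ∷ e₅ ∷ e₆ ∷ e₇ ∷ [] } refl =
    s ∷ r , 7 , (s , here refl) , un ,
    C₈.Realise.colouring C₈-valid G s _ refl un
      (e₀ ∷ e₁ ∷ e₂ ∷ e₃ ∷ e₄ ∷ e₅ ∷ e₆ ∷ E-sym G e₇ ∷ []) , ≤-refl

  -- On ℓ vertices ℓ colours save ℓ, so the general formula suffices from length 9 on.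
  long-cycle-saves-9 : ∀ C → 9 ≤ cycLength G C → Saving G 9
  long-cycle-saves-9 C 9≤ℓ = cverts G C , cycLength G C , (start C , here refl) , uniq C , cycle-colouring G C ,
    ≤-trans (+-monoʳ-≤ ℓ 9≤ℓ) (≤-reflexive (cong (ℓ +_) (sym (+-identityʳ ℓ))))
    where ℓ = cycLength G C

  -- The diameter condition itself supplies the distant pair; the six cycle vertices ensure that
  -- `n ∸ 3` is not truncated.
  J1-far : ∀ C → InJ1 G C → ∃ λ d → n ≡ 3 + d × 0 < d × FarApart d
  J1-far C (six , _ , diam) =
    n ∸ 3 , sym (m+[n∸m]≡n (≤-trans (m≤n+m 3 3) 6≤n)) , m<n⇒0<n∸m (≤-trans (m≤n+m 4 2) 6≤n) , HasDiam⇒FarApart diam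
    where
    6≤n : 6 ≤ n
    6≤n = subst (_≤ n) six (unique⇒length≤ (uniq C))

-- Classification of the graphs with a hexagon.

module _ {n : ℕ} (G : Graph n) (cn : Connected G) where

  private
    Vx = Fin n

  module HexagonalGraph {a₀ a₁ a₂ a₃ a₄ a₅ : Vx} (H : Hexagon G a₀ a₁ a₂ a₃ a₄ a₅) where
    open Hexagon H renaming (distinct to un)

    C : Cycle G
    C = record
      { start  = a₀
      ; rest   = a₁ ∷ a₂ ∷ a₃ ∷ a₄ ∷ a₅ ∷ []
      ; long   = s≤s (s≤s z≤n)
      ; uniq   = un
      ; closed = e₀₁ ∷ e₁₂ ∷ e₂₃ ∷ e₃₄ ∷ e₄₅ ∷ e₅₀ ∷ []
      }

    six : List Vx
    six = cverts G C

    a₃∈ : a₃ ∈ six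
    a₃∈ = there (there (there (here refl)))

    module B6 (ps : List Vx) (unP : Unique (a₀ ∷ ps)) (chF : Chain (F G C) (a₀ ∷ ps))
      (tree : ∀ x → (InTree G C a₀ x → x ∈ a₀ ∷ ps) × (x ∈ a₀ ∷ ps → InTree G C a₀ x))
      (treeEdge : ∀ x y → InTree G C a₀ x → F G C x y → (x , y) ∈ pairs (a₀ ∷ ps) ⊎ (y , x) ∈ pairs (a₀ ∷ ps))
      (trivial : ∀ w → w ∈ six → w ≢ a₀ → ¬ Nontrivial G C w) where

      -- A cycle vertex on the stem would have a tree edge to its predecessor and so a nontrivial
      -- tree, which only `a₀` may have; and `a₀` is not repeated on its own stem.
      off : ∀ {x} → x ∈ six → x ∉ ps
      off {x} x∈ x∈ps with y , yx ← pairs-pred {u = a₀} x∈ps =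
        trivial x x∈ (λ eq → Unique.Unique[x∷xs]⇒x∉xs unP (subst (_∈ ps) eq x∈ps))
          (Nontrivial-at G C (F-sym G C (All.lookup chF yx)))

      open Spine G cn a₀ a₁ a₂ a₃ a₄ a₅ ps [] public

      distinctVertices : Unique vertices
      distinctVertices = subst (λ z → Unique (six ++ z)) (sym (++-identityʳ ps))
        (Unique.++⁺ un (AllPairs.tail unP) (λ (p , q) → off p q))

      edges : ∀ {x y} → x ∈ vertices → E G x y →
        Listed (hexagon ++ a₀ ∷ []) x y ⊎ Listed (a₀ ∷ ps) x y ⊎ Listed (a₃ ∷ []) x y
      edges {x} {y} x∈ e with cycEdge? G C x y
      ... | yes c = inj₁ c
      ... | no ¬c = inj₂ (inj₁ (treeEdge x y (proj₂ (tree x) x∈P) (e , ¬c)))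
        where
        x∈P : x ∈ a₀ ∷ ps
        x∈P with ∈-++⁻ six x∈
        ... | inj₂ q = there (subst (x ∈_) (++-identityʳ ps) q)
        ... | inj₁ q with x ≟ a₀
        ...   | yes eq = here eq
        ...   | no ne  = contradiction (Nontrivial-at G C (e , ¬c)) (trivial x q ne)

      far : ∃ λ d → n ≡ 3 + d × 0 < d × FarApart G d
      far = 3 + (length ps + 0) , order distinctVertices edges , s≤s z≤n , _ , _ , far-apart distinctVertices edges

    module _ (uc : UniqueCycle G C) where
      open UC G C uc
      open Stem G C uc

      OffNeighbour : Vx → Set
      OffNeighbour v = ∃ λ y → E G v y × y ∉ six

      leaves-distinct : ∀ {u v x y} → u ∈ six → v ∈ six → u ≢ v → x ∉ six → E G u x → E G v y → x ≢ y
      leaves-distinct u∈ v∈ ne x∉ ex ey refl = shared-neighbour u∈ v∈ ne x∉ ex ey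

      module J1 (K₀ : ClosedPath G six a₀) (K₃ : ClosedPath G six a₃) (o₀ : OffNeighbour a₀) (o₃ : OffNeighbour a₃)
        (n₁ : ¬ OffNeighbour a₁) (n₂ : ¬ OffNeighbour a₂) (n₄ : ¬ OffNeighbour a₄) (n₅ : ¬ OffNeighbour a₅) where

        module P = Closed (here refl) K₀
        module Q = Closed a₃∈ K₃
        open Spine G cn a₀ a₁ a₂ a₃ a₄ a₅ P.ps Q.ps

        a₀≢a₃ : a₀ ≢ a₃
        a₀≢a₃ = All.lookup (AllPairs.head un) (there (there (here refl)))

        -- A common vertex would link `a₀` to `a₃` off the cycle edges, and `a₃` would lie on the
        -- stem at `a₀`.
        ps∉qs : ∀ {x} → x ∈ P.ps → x ∉ Q.ps
        ps∉qs p q with P.tree⇒path (here refl)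
          (P.path⇒tree (there p) ◅◅ Star.reverse (F-sym G C) (Q.path⇒tree (there q)))
        ... | here eq   = a₀≢a₃ (sym eq)
        ... | there a₃∈ = All.lookup P.off a₃∈ (there (there (there (here refl))))

        distinctVertices : Unique vertices
        distinctVertices = Unique.++⁺ un
          (Unique.++⁺ (AllPairs.tail P.unique) (AllPairs.tail Q.unique) (λ (p , q) → ps∉qs p q))
          (λ (v∈ , w) → [ (λ p → All.lookup P.off p v∈) , (λ q → All.lookup Q.off q v∈) ]′ (∈-++⁻ P.ps w))

        edges : ∀ {x y} → x ∈ vertices → E G x y →
          Listed (hexagon ++ a₀ ∷ []) x y ⊎ Listed (a₀ ∷ P.ps) x y ⊎ Listed (a₃ ∷ Q.ps) x y
        edges {x} {y} x∈ e with ∈-++⁻ six x∈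
        ... | inj₁ x∈C = onCycle x∈C
          where
          onCycle : x ∈ six → _
          onCycle x∈C with y ∈? six
          ... | yes y∈ = inj₁ (no-chord x∈C y∈ e)
          onCycle (here refl) | no y∉ with P.closed-under (here refl) e
          ... | inj₁ y∈ = contradiction y∈ y∉
          ... | inj₂ y∈ = inj₂ (inj₁ (P.consecutive (here refl) (there y∈) e))
          onCycle (there (here refl)) | no y∉ = contradiction (y , e , y∉) n₁
          onCycle (there (there (here refl))) | no y∉ = contradiction (y , e , y∉) n₂
          onCycle (there (there (there (here refl)))) | no y∉ with Q.closed-under (here refl) e
          ... | inj₁ y∈ = contradiction y∈ y∉
          ... | inj₂ y∈ = inj₂ (inj₂ (Q.consecutive (here refl) (there y∈) e))
          onCycle (there (there (there (there (here refl))))) | no y∉ = contradiction (y , e , y∉) n₄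
          onCycle (there (there (there (there (there (here refl)))))) | no y∉ = contradiction (y , e , y∉) n₅
        ... | inj₂ x∈T with ∈-++⁻ P.ps x∈T
        ...   | inj₁ p = inj₂ (inj₁ (P.consecutive (there p) (P.neighbour (there p) (e , λ c → All.lookup P.off p (proj₁ (cycEdge-∈ G C c)))) e))
        ...   | inj₂ q = inj₂ (inj₂ (Q.consecutive (there q) (Q.neighbour (there q) (e , λ c → All.lookup Q.off q (proj₁ (cycEdge-∈ G C c)))) e))

        d : ℕ
        d = 3 + (length P.ps + length Q.ps)

        n∸3≡d : n ∸ 3 ≡ d
        n∸3≡d = cong (_∸ 3) (order distinctVertices edges)

        -- Both stems are nonempty. This makes the crude bound 5 for two hexagon vertices
        -- sufficient.
        5≤d : 5 ≤ d
        5≤d = s≤s (s≤s (s≤s (+-mono-≤ (≢[]⇒1≤ (P.nonempty o₀)) (≢[]⇒1≤ (Q.nonempty o₃)))))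
          where
          ≢[]⇒1≤ : ∀ {xs : List Vx} → xs ≢ [] → 1 ≤ length xs
          ≢[]⇒1≤ {[]}    ne = contradiction refl ne
          ≢[]⇒1≤ {_ ∷ _} _  = s≤s z≤n

        -- Both stems and one side of the hexagon make up a single path with d + 1 vertices.
        module Along (m₁ m₂ : Vx) (un₄ : Unique (a₀ ∷ m₁ ∷ m₂ ∷ a₃ ∷ []))
          (on : ∀ {x} → x ∈ a₀ ∷ m₁ ∷ m₂ ∷ a₃ ∷ [] → x ∈ six)
          (e₁ : E G a₀ m₁) (e₂ : E G m₁ m₂) (e₃ : E G m₂ a₃) where

          L : List Vx
          L = reverse P.ps ++ (a₀ ∷ m₁ ∷ m₂ ∷ a₃ ∷ []) ++ Q.ps

          private
            back : ∀ {x} → x ∈ reverse P.ps → x ∈ P.ps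
            back = ∈-resp-↭ (↭-reverse P.ps)

          unL : Unique L
          unL = Unique.++⁺ (Unique-resp-↭ (↭-sym (↭-reverse P.ps)) (AllPairs.tail P.unique))
            (Unique.++⁺ un₄ (AllPairs.tail Q.unique) (λ (p , q) → All.lookup Q.off q (on p)))
            (λ (p , w) → [ (λ m → All.lookup P.off (back p) (on m)) , ps∉qs (back p) ]′ (∈-++⁻ (a₀ ∷ m₁ ∷ m₂ ∷ a₃ ∷ []) w))

          chL : Chain (E G) L
          chL = chain-join (reverse P.ps)
            (subst (Chain (E G)) (unfold-reverse a₀ P.ps) (chain-reverse (E-sym G) _ P.path))
            (e₁ ∷ e₂ ∷ e₃ ∷ Q.path)

          lenL : length L ≤ suc d
          lenL = ≤-reflexive (trans (length-++ (reverse P.ps))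
            (trans (cong (_+ (4 + length Q.ps)) (length-reverse P.ps)) (shuffle (length P.ps) (length Q.ps))))
            where
            shuffle : ∀ p q → p + (4 + q) ≡ 4 + (p + q)
            shuffle = solve-∀

          near : ∀ {x y} → x ∈ L → y ∈ L → DistLe G x y d
          near = path-DistLe G unL chL lenL

          inP : ∀ {x} → x ∈ P.ps → x ∈ L
          inP x∈ = ∈-++⁺ˡ (∈-resp-↭ (↭-sym (↭-reverse P.ps)) x∈)

          inM : ∀ {x} → x ∈ a₀ ∷ m₁ ∷ m₂ ∷ a₃ ∷ [] → x ∈ L
          inM x∈ = ∈-++⁺ʳ (reverse P.ps) (∈-++⁺ˡ x∈)

          inQ : ∀ {x} → x ∈ Q.ps → x ∈ L
          inQ x∈ = ∈-++⁺ʳ (reverse P.ps) (∈-++⁺ʳ (a₀ ∷ m₁ ∷ m₂ ∷ a₃ ∷ []) x∈)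

          inPQ : ∀ {x} → x ∈ P.ps ++ Q.ps → x ∈ L
          inPQ x∈ = [ inP , inQ ]′ (∈-++⁻ P.ps x∈)

        private
          forward backward : List Vx
          forward  = a₀ ∷ a₁ ∷ a₂ ∷ a₃ ∷ []
          backward = a₀ ∷ a₅ ∷ a₄ ∷ a₃ ∷ []

          onF : ∀ {x} → x ∈ forward → x ∈ six
          onF = ∈-++⁺ˡ

          onB : ∀ {x} → x ∈ backward → x ∈ six
          onB (here refl)                         = here refl
          onB (there (here refl))                 = there (there (there (there (there (here refl)))))
          onB (there (there (here refl)))         = there (there (there (there (here refl))))
          onB (there (there (there (here refl)))) = a₃∈

          unB : Unique backward
          unB = go un
            where
            go : Unique six → Unique backward
            go ((_ ∷ _ ∷ n₀₃ ∷ n₀₄ ∷ n₀₅ ∷ []) ∷ _ ∷ _ ∷ (n₃₄ ∷ n₃₅ ∷ []) ∷ (n₄₅ ∷ []) ∷ _) =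
              (n₀₅ ∷ n₀₄ ∷ n₀₃ ∷ []) ∷ (≢-sym n₄₅ ∷ ≢-sym n₃₅ ∷ []) ∷ (≢-sym n₃₄ ∷ []) ∷ [] ∷ []

          side : ∀ {x} → x ∈ six → x ∈ forward ⊎ x ∈ backward
          side (here refl)                                         = inj₁ (here refl)
          side (there (here refl))                                 = inj₁ (there (here refl))
          side (there (there (here refl)))                         = inj₁ (there (there (here refl)))
          side (there (there (there (here refl))))                 = inj₁ (there (there (there (here refl))))
          side (there (there (there (there (here refl)))))         = inj₂ (there (there (here refl)))
          side (there (there (there (there (there (here refl)))))) = inj₂ (there (here refl))

        module Fw = Along a₁ a₂ (Unique-++⁻ˡ forward un) onF e₀₁ e₁₂ e₂₃
        module Bw = Along a₅ a₄ unB onB (E-sym G e₅₀) (E-sym G e₄₅) (E-sym G e₃₄)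

        DistLe-mono : ∀ {x y k l} → k ≤ l → DistLe G x y k → DistLe G x y l
        DistLe-mono le (inj₁ eq)            = inj₁ eq
        DistLe-mono le (inj₂ (mid , p , q)) = inj₂ (mid , p , ≤-trans q le)

        close-together : ∀ x y → DistLe G x y d
        close-together x y with ∈-++⁻ six (covers distinctVertices edges x) | ∈-++⁻ six (covers distinctVertices edges y)
        ... | inj₂ p | inj₂ q = Fw.near (Fw.inPQ p) (Fw.inPQ q)
        ... | inj₁ p | inj₁ q = DistLe-mono 5≤d (hexagon-path G H p q)
        ... | inj₁ p | inj₂ q with side p
        ...   | inj₁ f = Fw.near (Fw.inM f) (Fw.inPQ q)
        ...   | inj₂ b = Bw.near (Bw.inM b) (Bw.inPQ q)
        close-together x y | inj₂ p | inj₁ q with side q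
        ...   | inj₁ f = Fw.near (Fw.inPQ p) (Fw.inM f)
        ...   | inj₂ b = Bw.near (Bw.inPQ p) (Bw.inM b)

        diameter : HasDiam G (n ∸ 3)
        diameter = subst (HasDiam G) (sym n∸3≡d)
          (close-together , _ , _ , λ k k<d dl → <⇒≱ k<d (far-apart distinctVertices edges dl))

      nontrivial : ∀ {v} → OffNeighbour v → Nontrivial G C v
      nontrivial (y , e , y∉) = Nontrivial-at G C (e , offCycle⇒¬CycEdge y∉)

      classify : OffNeighbour a₀ → Saving G 9 ⊎ InB6 G C ⊎ InJ1 G C
      classify o₀@(x , ex , x∉) with newNeighbour? G six a₁
      ... | yes (y , ey , y∉) = inj₁ (adjacentLeaves G H x∉ y∉
              (leaves-distinct (here refl) (there (here refl)) (E⇒≢ G e₀₁) x∉ ex ey) ex ey)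
      ... | no n₁ with newNeighbour? G six a₅
      ... | yes (y , ey , y∉) = inj₁ (adjacentLeaves G (turn G H) (y∉ ∘ ∈-resp-↭ rot) (x∉ ∘ ∈-resp-↭ rot)
              (leaves-distinct (∈-++⁺ʳ (a₀ ∷ a₁ ∷ a₂ ∷ a₃ ∷ a₄ ∷ []) (here refl)) (here refl) (E⇒≢ G e₅₀) y∉ ey ex) ey ex)
        where rot = ++-comm (a₅ ∷ []) (a₀ ∷ a₁ ∷ a₂ ∷ a₃ ∷ a₄ ∷ [])
      ... | no n₅ with newNeighbour? G six a₂
      ... | yes (y , ey , y∉) = inj₁ (spacedLeaves G H x∉ y∉
              (leaves-distinct (here refl) (there (there (here refl))) a₀≢a₂ x∉ ex ey) ex ey)
        where
        a₀≢a₂ : a₀ ≢ a₂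
        a₀≢a₂ = All.lookup (AllPairs.head un) (there (here refl))
      ... | no n₂ with newNeighbour? G six a₄
      ... | yes (y , ey , y∉) = inj₁ (spacedLeaves G (turn G (turn G H)) (y∉ ∘ ∈-resp-↭ rot) (x∉ ∘ ∈-resp-↭ rot)
              (leaves-distinct (∈-++⁺ʳ (a₀ ∷ a₁ ∷ a₂ ∷ a₃ ∷ []) (here refl)) (here refl) (≢-sym a₀≢a₄) y∉ ey ex) ey ex)
        where
        rot = ++-comm (a₄ ∷ a₅ ∷ []) (a₀ ∷ a₁ ∷ a₂ ∷ a₃ ∷ [])
        a₀≢a₄ : a₀ ≢ a₄
        a₀≢a₄ = All.lookup (AllPairs.head un) (there (there (there (here refl))))
      ... | no n₄ with exploreFrom G H
      ... | inj₁ s = inj₁ s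
      ... | inj₂ K₀ with newNeighbour? G six a₃
      ... | no n₃ = inj₂ (inj₁ (refl , a₀ , here refl , P.pathTree (P.nonempty o₀) , trivial))
        where
        module P = Closed (here refl) K₀
        trivial : ∀ w → w ∈ six → w ≢ a₀ → ¬ Nontrivial G C w
        trivial w w∈ ne = no-offNeighbour⇒trivial w∈ (none w∈ ne)
          where
          none : ∀ {w} → w ∈ six → w ≢ a₀ → ¬ OffNeighbour w
          none (here refl) ne = contradiction refl ne
          none (there (here refl)) _ = n₁
          none (there (there (here refl))) _ = n₂
          none (there (there (there (here refl)))) _ = n₃
          none (there (there (there (there (here refl))))) _ = n₄
          none (there (there (there (there (there (here refl)))))) _ = n₅
      ... | yes o₃ with exploreFrom G (turn G (turn G (turn G H)))
      ... | inj₁ s = inj₁ s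
      ... | inj₂ K₃ = inj₂ (inj₂ (refl ,
          (a₀ , a₃ , here refl , a₃∈ , J.a₀≢a₃ , nontrivial o₀ , nontrivial o₃ , only) , J.diameter))
        where
        module J = J1 K₀ (ClosedPath-resp G (++-comm (a₃ ∷ a₄ ∷ a₅ ∷ []) (a₀ ∷ a₁ ∷ a₂ ∷ [])) K₃) o₀ o₃ n₁ n₂ n₄ n₅
        only : ∀ w → w ∈ six → Nontrivial G C w → w ≡ a₀ ⊎ w ≡ a₃
        only w (here refl) _ = inj₁ refl
        only w w∈@(there (here refl)) nt = contradiction nt (no-offNeighbour⇒trivial w∈ n₁)
        only w w∈@(there (there (here refl))) nt = contradiction nt (no-offNeighbour⇒trivial w∈ n₂)
        only w (there (there (there (here refl)))) _ = inj₂ refl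
        only w w∈@(there (there (there (there (here refl))))) nt = contradiction nt (no-offNeighbour⇒trivial w∈ n₄)
        only w w∈@(there (there (there (there (there (here refl)))))) nt = contradiction nt (no-offNeighbour⇒trivial w∈ n₅)

  saving⇒TRC : ∀ {c} → Saving G c → ∃ λ l → l + c ≤ 2 * n × TRCColorable G l
  saving⇒TRC (S , k , (_ , u∈) , un , col , le) = spread G cn _ u∈ un col le

  hexagon-classify : ∀ C → cycLength G C ≡ 6 → UniqueCycle G C → (∃ λ y → E G (start C) y × y ∉ cverts G C) →
                     Saving G 9 ⊎ InB6 G C ⊎ InJ1 G C
  hexagon-classify record { rest = _ ∷ _ ∷ _ ∷ _ ∷ _ ∷ [] ; uniq = un ; closed = e₀ ∷ e₁ ∷ e₂ ∷ e₃ ∷ e₄ ∷ e₅ ∷ [] } refl uc o =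
    HexagonalGraph.classify (hex un e₀ e₁ e₂ e₃ e₄ e₅) uc o

  B6-far : ∀ C → UniqueCycle G C → InB6 G C → ∃ λ d → n ≡ 3 + d × 0 < d × FarApart G d
  B6-far C uc (six , u , b@(u∈ , _)) with C′ , refl , perm ← rotate G C u∈ =
    go C′ (trans (sym (↭-length perm)) six) (Transfer.b6At G {C} {C′} (uc C′) perm b)
    where
    go : ∀ C → cycLength G C ≡ 6 → B6At G C (start C) → ∃ λ d → n ≡ 3 + d × 0 < d × FarApart G d
    go record { rest = _ ∷ _ ∷ _ ∷ _ ∷ _ ∷ [] ; uniq = un ; closed = e₀ ∷ e₁ ∷ e₂ ∷ e₃ ∷ e₄ ∷ e₅ ∷ [] } refl
       (_ , (ps , _ , unP , ch , tr , ed) , triv) =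
      HexagonalGraph.B6.far (hex un e₀ e₁ e₂ e₃ e₄ e₅) ps unP ch tr ed triv

  offCycle-neighbour : ∀ C → UniqueCycle G C → ¬ IsCycleGraph G → ∃₂ λ y x → y ∈ cverts G C × x ∉ cverts G C × E G y x
  offCycle-neighbour C uc ¬cyc with crossing-or-all G cn {cverts G C} (here refl)
  ... | inj₁ all = contradiction (C , all , λ x y e → UC.no-chord G C uc (all x) (all y) e) ¬cyc
  ... | inj₂ cr  = cr

  saves-9 : ∀ C → UniqueCycle G C → ¬ IsCycleGraph G → 6 ≤ cycLength G C → ¬ (InB6 G C ⊎ InJ1 G C) → Saving G 9
  saves-9 C uc ¬cyc 6≤ℓ ¬exc with offCycle-neighbour C uc ¬cyc
  ... | y , x , y∈ , x∉ , e with C′ , refl , perm ← rotate G C y∈ = byLength (cycLength G C) refl 6≤ℓ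
    where
    off : ∃ λ z → E G (start C′) z × z ∉ cverts G C′
    off = x , e , x∉ ∘ ∈-resp-↭ (↭-sym perm)
    module T = Transfer G {C′} {C} (SameCycle-sym G {C} {C′} (uc C′)) (↭-sym perm)

    byLength : ∀ ℓ → cycLength G C ≡ ℓ → 6 ≤ ℓ → Saving G 9
    byLength 6 eq _ with hexagon-classify C′ (trans (sym (↭-length perm)) eq) (UniqueCycle-resp G {C} C′ uc) off
    ... | inj₁ s        = s
    ... | inj₂ (inj₁ b) = contradiction (inj₁ (T.inB6 b)) ¬exc
    ... | inj₂ (inj₂ j) = contradiction (inj₂ (T.inJ1 j)) ¬exc
    byLength 7 eq _ = heptagon-saves-9 G C′ (trans (sym (↭-length perm)) eq) off
    byLength 8 eq _ = octagon-saves-9 G C eq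
    byLength (suc (suc (suc (suc (suc (suc (suc (suc (suc ℓ))))))))) eq _ =
      long-cycle-saves-9 G C (subst (9 ≤_) (sym eq) (m≤m+n 9 ℓ))
    byLength 0 _ ()
    byLength 1 _ (s≤s ())
    byLength 2 _ (s≤s (s≤s ()))
    byLength 3 _ (s≤s (s≤s (s≤s ())))
    byLength 4 _ (s≤s (s≤s (s≤s (s≤s ()))))
    byLength 5 _ (s≤s (s≤s (s≤s (s≤s (s≤s ())))))

theorem3p3 : (n : ℕ) (G : Graph n) → Connected G → (C : Cycle G) → UniqueCycle G C
    → ¬ IsCycleGraph G → 6 ≤ cycLength G C
    → ((InB6 G C ⊎ InJ1 G C) → TrcIs G (2 * n ∸ 7))
      × (¬ (InB6 G C ⊎ InJ1 G C) → TrcAtMost G (2 * n ∸ 9))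
theorem3p3 n G cn C uc ¬cyc 6≤ℓ = exceptional , general
  where
  exceptional : InB6 G C ⊎ InJ1 G C → TrcIs G (2 * n ∸ 7)
  exceptional x with [ B6-far G cn C uc , J1-far G C ]′ x
  ... | d , n≡ , 0<d , far = exact-trc G n≡ 0<d far (saving⇒TRC G cn (hexagon-saves-7 G C ([ proj₁ , proj₁ ]′ x)))

  general : ¬ (InB6 G C ⊎ InJ1 G C) → TrcAtMost G (2 * n ∸ 9)
  general ¬exc with l , l+9≤ , trc ← saving⇒TRC G cn (saves-9 G cn C uc ¬cyc 6≤ℓ ¬exc) =
    l , m+n≤o⇒m≤o∸n l l+9≤ , trc
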